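{- As formal power series in $t$ and $z$ with coefficients in $\mathbb{Z}[p]$, $$\sum_{n\ge0}\frac{\mathcal F_n(p,t)}{(1-t)^{n+1}}\,z^n=\sum_{m\ge0}t^m\,\frac{(1+pz)^m}{(1-pz)^{m+1}(1-z^2)^{m(m+1)}},$$ where $$\mathcal F_n(p,t)=\sum_{\pi\in\mathcal I_n^B}p^{\operatorname{fix}_B(\pi)}\,t^{\operatorname{des}^B(\pi)}.$$
   Context: For $n\ge1$, the hyperoctahedral group $\mathfrak B_n$ is the group of signed permutations: words $\pi=\pi_1\cdots\pi_n$ of nonzero integers such that $|\pi_1|,\dots,|\pi_n|$ is a permutation of $[n]=\{1,\dots,n\}$, identified with bijections of $\{\pm1,\dots,\pm n\}$ via $\pi(i)=\pi_i$, $\pi(-i)=-\pi(i)$. $\mathcal I_n^B$ is the set of involutions of $\mathfrak B_n$, i.e. elements with $\pi^2=\mathrm{id}$ (including the identity). For $n=0$, $\mathcal I_0^B$ consists of the empty signed permutation, so $\mathcal F_0(p,t)=1$. With $\pi_0=0$ and the usual order on $\mathbb Z$ (natural order), $\operatorname{des}^B(\pi)=\#\{i\in\{0,1,\dots,n-1\}:\pi_i>\pi_{i+1}\}$. The number of fixed positions is $\operatorname{fix}_B(\pi)=\#\{i\in[n]:|\pi(i)|=i\}$ (both $\pi(i)=i$ and $\pi(i)=-i$ count). -}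

module Defs where

open import Algebra.Bundles using (Ring)
open import Algebra.Bundles.Raw using (RawRing)
import Algebra.Definitions.RawMonoid as RawMonoidDefs
import Algebra.Definitions.RawSemiring as RawSemiringDefs
import Algebra.Properties.CommutativeMonoid.Sum as SumProperties
open import Data.Fin.Base using (Fin; zero; suc; toℕ; inject₁)
import Data.Fin.Properties as Fin
open import Data.Integer.Base as ℤ using (ℤ; 0ℤ; _◃_)
import Data.Integer.Properties as ℤ
open import Data.List.Base as List using (List; []; _∷_)
open import Data.Nat.Base as ℕ using (ℕ; zero; suc; _∸_)
open import Data.Product.Base using (_×_; _,_; ∃; proj₁; proj₂; map₁)
open import Data.Product.Properties using (≡-dec)
open import Data.Sign.Base as Sign using (Sign)
import Data.Sign.Properties as Sign
open import Data.Vec.Base as Vec using (Vec; []; _∷_; lookup)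
open import Function.Base using (_∘_)
open import Function.Definitions using (Injective; Surjective; Bijective)
open import Function.Consequences.Propositional
  using (strictlySurjective⇒surjective; surjective⇒strictlySurjective)
open import Level using (Level; 0ℓ)
open import Relation.Binary.PropositionalEquality as ≡ using (_≡_)
open import Relation.Nullary.Decidable using (Dec; map′; _×-dec_; _→-dec_)

private
  variable
    c ℓ : Level
    A : Set
    n : ℕ

------------------------------------------------------------------------
-- Polynomials and formal power series

-- Polynomials are coefficient lists, constant term first.  Trailing zeros are
-- allowed, so the ring equality compares coefficients.
module Polynomial (R : RawRing c ℓ) where
  private module R = RawRing R

  coeff : List R.Carrier → ℕ → R.Carrier
  coeff []      _       = R.0#
  coeff (a ∷ f) zero    = a
  coeff (a ∷ f) (suc k) = coeff f k

  private
    add : List R.Carrier → List R.Carrier → List R.Carrier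
    add []      g       = g
    add (a ∷ f) []      = a ∷ f
    add (a ∷ f) (b ∷ g) = (a R.+ b) ∷ add f g

    mul : List R.Carrier → List R.Carrier → List R.Carrier
    mul []      g = []
    mul (a ∷ f) g = add (List.map (a R.*_) g) (R.0# ∷ mul f g)

  rawRing : RawRing c ℓ
  rawRing = record
    { Carrier = List R.Carrier
    ; _≈_     = λ f g → ∀ k → coeff f k R.≈ coeff g k
    ; _+_     = add
    ; _*_     = mul
    ; -_      = List.map (R.-_)
    ; 0#      = []
    ; 1#      = R.1# ∷ []
    }

  open RawRing rawRing public
  open RawSemiringDefs rawSemiring public using (_^_)

  X : Carrier
  X = R.0# ∷ R.1# ∷ []

module PowerSeries (R : RawRing c ℓ) where
  private
    module R = RawRing R
    open RawMonoidDefs R.+-rawMonoid using () renaming (sum to sumᴿ)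

    constant : R.Carrier → ℕ → R.Carrier
    constant a zero    = a
    constant a (suc _) = R.0#

  rawRing : RawRing c ℓ
  rawRing = record
    { Carrier = ℕ → R.Carrier
    ; _≈_     = λ f g → ∀ k → f k R.≈ g k
    ; _+_     = λ f g k → f k R.+ g k
    ; _*_     = λ f g k → sumᴿ {suc k} (λ i → f (toℕ i) R.* g (k ∸ toℕ i))
    ; -_      = λ f k → R.- f k
    ; 0#      = λ _ → R.0#
    ; 1#      = constant R.1#
    }

  open RawRing rawRing public
  open RawSemiringDefs rawSemiring public using (_^_; sum)

  infixl 6 _-_
  _-_ : Carrier → Carrier → Carrier
  f - g = f + (- g)

  const : R.Carrier → Carrier
  const = constant

  X : Carrier
  X zero          = R.0#
  X (suc zero)    = R.1#
  X (suc (suc _)) = R.0#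

  sumList : List Carrier → Carrier
  sumList = List.foldr _+_ 0#

  -- The coefficients g_k , … , g_0 (in this order) of the inverse g of a
  -- series f with constant term 1, from
  --   g_0 = 1,   g_{k+1} = - (f_1 g_k + f_2 g_{k-1} + … + f_{k+1} g_0).
  inverseCoeffs : Carrier → ∀ k → Vec R.Carrier (suc k)
  inverseCoeffs f zero    = R.1# ∷ []
  inverseCoeffs f (suc k) =
    (R.- sumᴿ (λ i → f (suc (toℕ i)) R.* lookup gs i)) ∷ gs
    where gs = inverseCoeffs f k

  -- Meaningful only when the constant term is 1; see *-inverseʳ below.
  inverse : Carrier → Carrier
  inverse f k = Vec.head (inverseCoeffs f k)

  infixl 7 _/_
  _/_ : Carrier → Carrier → Carrier
  f / g = f * inverse g

module _ (R : Ring c ℓ) where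
  private
    module R = Ring R
    open PowerSeries R.rawRing
    open SumProperties R.+-commutativeMonoid using (sum-cong-≋)

    lookup-inverseCoeffs : ∀ f k (i : Fin (suc k)) →
      lookup (inverseCoeffs f k) i ≡ inverse f (k ∸ toℕ i)
    lookup-inverseCoeffs f zero    zero    = ≡.refl
    lookup-inverseCoeffs f (suc k) zero    = ≡.refl
    lookup-inverseCoeffs f (suc k) (suc i) = lookup-inverseCoeffs f k i

  *-inverseʳ : ∀ f → f 0 R.≈ R.1# → f * inverse f ≈ 1#
  *-inverseʳ f f₀≈1 zero =
    R.trans (R.+-identityʳ _) (R.trans (R.*-identityʳ _) f₀≈1)
  *-inverseʳ f f₀≈1 (suc k) =
    R.trans
      (R.+-cong
        (R.trans (R.*-congʳ f₀≈1) (R.*-identityˡ _))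
        (sum-cong-≋ λ i → R.*-congˡ {f (suc (toℕ i))}
          (R.reflexive (≡.sym (lookup-inverseCoeffs f k i)))))
      (R.-‿inverseˡ _)

module ℤ[p]       = Polynomial  ℤ.+-*-rawRing
module ℤ[p]⟦t⟧    = PowerSeries ℤ[p].rawRing
module ℤ[p]⟦t⟧⟦z⟧ = PowerSeries ℤ[p]⟦t⟧.rawRing

p t z : ℤ[p]⟦t⟧⟦z⟧.Carrier
p = ℤ[p]⟦t⟧⟦z⟧.const (ℤ[p]⟦t⟧.const ℤ[p].X)
t = ℤ[p]⟦t⟧⟦z⟧.const ℤ[p]⟦t⟧.X
z = ℤ[p]⟦t⟧⟦z⟧.X

-- Σ_{m ≥ 0} a_m = s as formal power series in t and z: every coefficient
-- [t^i z^j] of the partial sums is eventually that of s.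
HasSum : (ℕ → ℤ[p]⟦t⟧⟦z⟧.Carrier) → ℤ[p]⟦t⟧⟦z⟧.Carrier → Set
HasSum a s = ∀ i j → ∃ λ N → ∀ n → N ℕ.≤ n →
  ℤ[p]⟦t⟧⟦z⟧.sum {n} (a ∘ toℕ) j i ℤ[p].≈ s j i

------------------------------------------------------------------------
-- Signed permutations

-- The set {±1, …, ±n}; the letter (s , k) stands for s (k + 1).
±[_] : ℕ → Set
±[ n ] = Sign × Fin n

toℤ : ±[ n ] → ℤ
toℤ (s , k) = s ◃ suc (toℕ k)

Word : ℕ → Set
Word n = Vec ±[ n ] n

∣_∣ʷ : Word n → Fin n → Fin n
∣ π ∣ʷ i = proj₂ (lookup π i)

IsSignedPermutation : Word n → Set
IsSignedPermutation π = Bijective _≡_ _≡_ ∣ π ∣ʷ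

-- The action on {±1, …, ±n}, with π(-i) = -π(i).
_⟨_⟩ : Word n → ±[ n ] → ±[ n ]
π ⟨ s , i ⟩ = map₁ (s Sign.*_) (lookup π i)

IsInvolution : Word n → Set
IsInvolution π = ∀ s i → π ⟨ π ⟨ s , i ⟩ ⟩ ≡ (s , i)

isSignedPermutation? : (π : Word n) → Dec (IsSignedPermutation π)
isSignedPermutation? π = injective? ×-dec surjective?
  where
  injective? : Dec (Injective _≡_ _≡_ ∣ π ∣ʷ)
  injective? = map′ (λ h {i} {j} → h i j) (λ h i j → h {i} {j})
    (Fin.all? λ i → Fin.all? λ j → (∣ π ∣ʷ i Fin.≟ ∣ π ∣ʷ j) →-dec (i Fin.≟ j))

  surjective? : Dec (Surjective _≡_ _≡_ ∣ π ∣ʷ)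
  surjective? = map′ strictlySurjective⇒surjective surjective⇒strictlySurjective
    (Fin.all? λ k → Fin.any? λ i → ∣ π ∣ʷ i Fin.≟ k)

isInvolution? : (π : Word n) → Dec (IsInvolution π)
isInvolution? π =
  map′ (λ { (f , g) Sign.+ → f ; (f , g) Sign.- → g }) (λ h → h Sign.+ , h Sign.-)
    (check Sign.+ ×-dec check Sign.-)
  where
  check : ∀ s → Dec (∀ i → π ⟨ π ⟨ s , i ⟩ ⟩ ≡ (s , i))
  check s = Fin.all? λ i → ≡-dec Sign._≟_ Fin._≟_ (π ⟨ π ⟨ s , i ⟩ ⟩) (s , i)

vectors : List A → ∀ k → List (Vec A k)
vectors xs zero    = [] ∷ []
vectors xs (suc k) = List.cartesianProductWith _∷_ xs (vectors xs k)

𝔅 : ∀ n → List (Word n)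
𝔅 n = List.filter isSignedPermutation? (vectors letters n)
  where letters = List.cartesianProduct (Sign.+ ∷ Sign.- ∷ []) (List.allFin n)

𝓘ᴮ : ∀ n → List (Word n)
𝓘ᴮ n = List.filter isInvolution? (𝔅 n)

desᴮ : Word n → ℕ
desᴮ {n} π = Vec.count (λ i → lookup w (suc i) ℤ.<? lookup w (inject₁ i)) (Vec.allFin n)
  where w = 0ℤ ∷ Vec.map toℤ π

fixᴮ : Word n → ℕ
fixᴮ {n} π = Vec.count (λ i → ∣ π ∣ʷ i Fin.≟ i) (Vec.allFin n)

𝓕 : ℕ → ℤ[p]⟦t⟧.Carrier
𝓕 n = sumList (List.map (λ π → const (ℤ[p].X ℤ[p].^ fixᴮ π) * X ^ desᴮ π) (𝓘ᴮ n))
  where open ℤ[p]⟦t⟧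

{-# OPTIONS --safe #-}
-- The coefficient of t^m in 𝓕_n / (1 - t)^{n+1} is the sum of p^{fix_B(π)} over
-- the pairs (π , f) with π ∈ 𝓘_n^B and f : [n] → {0, …, m} such that
-- (0 , 0), (f_1 , π_1), …, (f_n , π_n) increases lexicographically.  Give position
-- i the label (f(i), sign of π_i, f(|π_i|)).  The labels are then sorted, and their
-- multiplicities N are invariant under (a, s, b) ↦ (b, s, a) and vanish on the
-- labels with s = - and ab = 0.  Conversely N determines the sorted labels, and |π|
-- is recovered because it maps the positions labelled (a, s, b) to those labelled
-- (b, s, a), increasingly for s = + and decreasingly for s = -.  All positions
-- labelled (a, +, a) are fixed, those labelled (a, -, a) are fixed up to pairing,
-- and no others are.  Hence (a, +, a) contributes the factor 1 / (1 - pz),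
-- (a, -, a) the factor (1 + pz) / (1 - z²), and each of the m² remaining orbits
-- the factor 1 / (1 - z²).
module Submission where

open import Defs
open import Algebra.Bundles using (CommutativeMonoid; CommutativeRing)
open import Algebra.Bundles.Raw using (RawRing)
import Algebra.Construct.Pointwise as Pointwise
import Algebra.Definitions.RawMonoid as RawMonoid
import Algebra.Definitions.RawSemiring as RawSemiring
open import Algebra.Morphism.Structures using (IsRingMonomorphism)
import Algebra.Morphism.RingMonomorphism as RingMonomorphism
import Algebra.Properties.CommutativeSemigroup as CommutativeSemigroup
import Algebra.Properties.Monoid.Sum as MonoidSum
import Algebra.Properties.Ring as RingProperties
open import Data.Bool.Base using (if_then_else_)
open import Data.Fin.Base as Fin using (Fin; zero; suc; toℕ; fromℕ<; inject₁; opposite; punchOut; combine; remQuot; splitAt; join; _↑ˡ_; _↑ʳ_)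
open import Data.Fin.Permutation as Perm using (Permutation; _⟨$⟩ʳ_; _⟨$⟩ˡ_)
import Data.Fin.Properties as Fin
open import Data.Integer.Base as ℤ using (ℤ; 0ℤ)
import Data.Integer.Properties as ℤ
open import Data.List.Base as List using (List; []; _∷_; _++_; map; concatMap; cartesianProductWith; allFin; length; replicate)
import Data.List.Properties as List
open import Data.List.Membership.Propositional using (_∈_; lose; find)
open import Data.List.Membership.Propositional.Properties
  using (∈-map⁺; ∈-map⁻; ∈-++⁺ˡ; ∈-++⁺ʳ; ∈-++⁻; ∈-filter⁺; ∈-filter⁻; ∈-allFin; ∈-concatMap⁺; ∈-concatMap⁻;
         ∈-cartesianProduct⁺; ∈-cartesianProductWith⁺; ∈-cartesianProductWith⁻)
open import Data.List.Membership.Propositional.Properties.WithK using (unique∧set⇒bag)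
open import Data.List.Relation.Binary.BagAndSetEquality using (∼bag⇒↭)
open import Data.List.Relation.Binary.Permutation.Propositional as ↭ using (_↭_)
open import Data.List.Relation.Unary.All as All using (All; []; _∷_)
import Data.List.Relation.Unary.All.Properties as All
open import Data.List.Relation.Unary.AllPairs using (AllPairs; []; _∷_)
open import Data.List.Relation.Unary.Any as Any using (here; there)
open import Data.List.Relation.Unary.Unique.Propositional using (Unique)
import Data.List.Relation.Unary.Unique.Propositional.Properties as Unique
open import Data.Nat.Base as ℕ using (ℕ; zero; suc; _∸_; z≤n; s≤s; s≤s⁻¹; z<s; s<s; s<s⁻¹)
import Data.Nat.Properties as ℕ
open import Data.Nat.Tactic.RingSolver using (solve-∀)
open import Algebra.Properties.CommutativeMonoid.Sum ℕ.+-0-commutativeMonoid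
  using (∑-comm; ∑-distrib-+; sum-permute; sum-cong-≗) renaming (sum to ∑)
open import Data.Product.Base using (∃; _×_; _,_; proj₁; proj₂)
open import Data.Product.Properties using (,-injectiveˡ; ,-injectiveʳ)
open import Data.Sign.Base as Sign using (Sign)
import Data.Sign.Properties as Sign
open import Data.Sum.Base using (_⊎_; inj₁; inj₂)
open import Data.Unit.Base using (⊤; tt)
open import Data.Vec.Base as Vec using (Vec; []; _∷_; lookup; tabulate)
import Data.Vec.Properties as Vec
open import Function.Base using (_∘_; id)
open import Function.Bundles using (mk⇔)
open import Function.Consequences.Propositional using (strictlySurjective⇒surjective)
open import Function.Definitions using (Injective)
open import Level using (Level; 0ℓ; _⊔_)
open import Relation.Binary.Core using (Rel)
open import Relation.Binary.Definitions using (tri<; tri≈; tri>)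
open import Relation.Binary.PropositionalEquality as ≡
  using (_≡_; _≢_; refl; cong; cong₂; subst; subst₂)
import Relation.Binary.Reasoning.Setoid as SetoidReasoning
open import Relation.Nullary using (Dec; yes; no; does; ¬_; contradiction)
open import Relation.Nullary.Decidable using (_⊎-dec_)

-- The power of 1 / (1 - t) is used up letter by letter: each letter contributes 1 / (1 - t) for the
-- choice of its block and a further t when a descent forbids the previous block. The last factor
-- comes from the empty word, which has one chain for every m. The chain starts at (0 , 0), so a
-- negative letter cannot lie in block 0. As π is an involution, position |π_i| carries the same
-- sign, which excludes a = 0 and b = 0 alike. Within a block the letters increase and f is
-- monotone, so s f(|π_i|) increases weakly, with negative signs first. Hence the labels, ordered by
-- a and then by s b, are sorted along the positions. Equal labels leave open only the order of |π|
-- on their class, and the absence of descents fixes it. Of the m² orbits with a ≠ b, m(m+1)/2 are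
-- positive and m(m-1)/2 negative. Together with the m labels (a , - , a) they give the exponent
-- m(m+1). Quotients are computed by cross-multiplication, over an arbitrary commutative ring with
-- an element x in place of p.

private
  variable
    c ℓ : Level
    A B : Set

-- Power series and polynomial rings

module SeriesRing (R : CommutativeRing c ℓ) where
  private
    module R = CommutativeRing R
    module S = CommutativeSemigroup R.+-commutativeSemigroup
    open PowerSeries R.rawRing
    open SetoidReasoning R.setoid

    infixr 7 _·_
    _·_ : R.Carrier → Carrier → Carrier
    (a · f) k = a R.* f k

    tail : Carrier → Carrier
    tail f = f ∘ suc

    -- (f * g) (suc k) unfolds to f 0 · g (suc k) + (tail f * g) k.
    *-cong : ∀ {f f′ g g′} → f ≈ f′ → g ≈ g′ → f * g ≈ f′ * g′
    *-cong f≈ g≈ zero    = R.+-congʳ (R.*-cong (f≈ 0) (g≈ 0))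
    *-cong f≈ g≈ (suc k) =
      R.+-cong (R.*-cong (f≈ 0) (g≈ (suc k))) (*-cong (f≈ ∘ suc) g≈ k)

    zeroˡ : ∀ g → 0# * g ≈ 0#
    zeroˡ g zero    = R.trans (R.+-identityʳ _) (R.zeroˡ _)
    zeroˡ g (suc k) = R.trans (R.+-cong (R.zeroˡ _) (zeroˡ g k)) (R.+-identityˡ _)

    const-* : ∀ a g → const a * g ≈ a · g
    const-* a g zero    = R.+-identityʳ _
    const-* a g (suc k) = R.trans (R.+-congˡ (zeroˡ g k)) (R.+-identityʳ _)

    ·-* : ∀ a f g → (a · f) * g ≈ a · (f * g)
    ·-* a f g zero    = begin
      (a R.* f 0) R.* g 0 R.+ R.0#   ≈⟨ R.+-identityʳ _ ⟩
      (a R.* f 0) R.* g 0            ≈⟨ R.*-assoc _ _ _ ⟩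
      a R.* (f 0 R.* g 0)            ≈⟨ R.*-congˡ (R.+-identityʳ _) ⟨
      a R.* (f 0 R.* g 0 R.+ R.0#)   ∎
    ·-* a f g (suc k) = begin
      (a R.* f 0) R.* g (suc k) R.+ ((a · tail f) * g) k
        ≈⟨ R.+-cong (R.*-assoc _ _ _) (·-* a (tail f) g k) ⟩
      a R.* (f 0 R.* g (suc k)) R.+ a R.* (tail f * g) k
        ≈⟨ R.distribˡ _ _ _ ⟨
      a R.* (f * g) (suc k) ∎

    distribʳ : ∀ h f g → (f + g) * h ≈ f * h + g * h
    distribʳ h f g zero    = begin
      (f 0 R.+ g 0) R.* h 0 R.+ R.0#                   ≈⟨ R.+-identityʳ _ ⟩
      (f 0 R.+ g 0) R.* h 0                            ≈⟨ R.distribʳ _ _ _ ⟩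
      f 0 R.* h 0 R.+ g 0 R.* h 0
        ≈⟨ R.+-cong (R.+-identityʳ _) (R.+-identityʳ _) ⟨
      (f 0 R.* h 0 R.+ R.0#) R.+ (g 0 R.* h 0 R.+ R.0#) ∎
    distribʳ h f g (suc k) = begin
      (f 0 R.+ g 0) R.* h (suc k) R.+ ((tail f + tail g) * h) k
        ≈⟨ R.+-cong (R.distribʳ _ _ _) (distribʳ h (tail f) (tail g) k) ⟩
      (f 0 R.* h (suc k) R.+ g 0 R.* h (suc k)) R.+ ((tail f * h) k R.+ (tail g * h) k)
        ≈⟨ S.interchange _ _ _ _ ⟩
      (f * h) (suc k) R.+ (g * h) (suc k) ∎

    *-assoc : ∀ f g h → (f * g) * h ≈ f * (g * h)
    *-assoc f g h zero    = begin
      (f 0 R.* g 0 R.+ R.0#) R.* h 0 R.+ R.0#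
        ≈⟨ R.+-congʳ (R.*-congʳ (R.+-identityʳ _)) ⟩
      (f 0 R.* g 0) R.* h 0 R.+ R.0#
        ≈⟨ R.+-congʳ (R.*-assoc _ _ _) ⟩
      f 0 R.* (g 0 R.* h 0) R.+ R.0#
        ≈⟨ R.+-congʳ (R.*-congˡ (R.+-identityʳ _)) ⟨
      f 0 R.* (g 0 R.* h 0 R.+ R.0#) R.+ R.0# ∎
    *-assoc f g h (suc k) = begin
      (f 0 R.* g 0 R.+ R.0#) R.* h (suc k) R.+ ((f 0 · tail g + tail f * g) * h) k
        ≈⟨ R.+-cong (R.trans (R.*-congʳ (R.+-identityʳ _)) (R.*-assoc _ _ _))
             (distribʳ h (f 0 · tail g) (tail f * g) k) ⟩
      f 0 R.* (g 0 R.* h (suc k)) R.+ (((f 0 · tail g) * h) k R.+ ((tail f * g) * h) k)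
        ≈⟨ R.+-congˡ (R.+-cong (·-* (f 0) (tail g) h k) (*-assoc (tail f) g h k)) ⟩
      f 0 R.* (g 0 R.* h (suc k)) R.+ (f 0 R.* (tail g * h) k R.+ (tail f * (g * h)) k)
        ≈⟨ R.+-assoc _ _ _ ⟨
      (f 0 R.* (g 0 R.* h (suc k)) R.+ f 0 R.* (tail g * h) k) R.+ (tail f * (g * h)) k
        ≈⟨ R.+-congʳ (R.distribˡ _ _ _) ⟨
      f 0 R.* (g * h) (suc k) R.+ (tail f * (g * h)) k ∎

    -- The product unfolds along its first factor only. This mirror recursion is what lets
    -- commutativity go by induction.
    *-sucʳ : ∀ f g k → (f * g) (suc k) R.≈ f (suc k) R.* g 0 R.+ (f * tail g) k
    *-sucʳ f g zero    = begin
      f 0 R.* g 1 R.+ (f 1 R.* g 0 R.+ R.0#)  ≈⟨ S.x∙yz≈y∙xz _ _ _ ⟩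
      f 1 R.* g 0 R.+ (f 0 R.* g 1 R.+ R.0#)  ∎
    *-sucʳ f g (suc k) = begin
      f 0 R.* g (2 ℕ.+ k) R.+ (tail f * g) (suc k)
        ≈⟨ R.+-congˡ (*-sucʳ (tail f) g k) ⟩
      f 0 R.* g (2 ℕ.+ k) R.+ (f (2 ℕ.+ k) R.* g 0 R.+ (tail f * tail g) k)
        ≈⟨ S.x∙yz≈y∙xz _ _ _ ⟩
      f (2 ℕ.+ k) R.* g 0 R.+ (f * tail g) (suc k) ∎

    *-comm : ∀ f g → f * g ≈ g * f
    *-comm f g zero    = R.+-congʳ (R.*-comm _ _)
    *-comm f g (suc k) = begin
      f 0 R.* g (suc k) R.+ (tail f * g) k  ≈⟨ R.+-cong (R.*-comm _ _) (*-comm (tail f) g k) ⟩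
      g (suc k) R.* f 0 R.+ (g * tail f) k  ≈⟨ *-sucʳ g f k ⟨
      (g * f) (suc k) ∎

    *-identityˡ : ∀ g → 1# * g ≈ g
    *-identityˡ g k = R.trans (const-* R.1# g k) (R.*-identityˡ _)

  commutativeRing : CommutativeRing c ℓ
  commutativeRing = record
    { isCommutativeRing = record
      { isRing = record
        { +-isAbelianGroup = Pointwise.isAbelianGroup ℕ R.+-isAbelianGroup
        ; *-cong           = *-cong
        ; *-assoc          = *-assoc
        ; *-identity       = *-identityˡ ,
            λ f k → R.trans (*-comm f 1# k) (*-identityˡ f k)
        ; distrib          =
            (λ h f g k → R.trans (*-comm h (f + g) k)
               (R.trans (distribʳ h f g k) (R.+-cong (*-comm f h k) (*-comm g h k)))) ,
            distribʳ
        }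
      ; *-comm = *-comm
      }
    }

  open CommutativeRing commutativeRing using (setoid; trans; sym; *-congʳ; *-congˡ; *-identityʳ; ring)

  const-*≈ : ∀ a g k → (const a * g) k R.≈ a R.* g k
  const-*≈ = const-*

  X*-zero : ∀ f → (X * f) 0 R.≈ R.0#
  X*-zero f = R.trans (R.+-identityʳ _) (R.zeroˡ _)

  X*-suc : ∀ f k → (X * f) (suc k) R.≈ f k
  X*-suc f k = R.trans (R.+-congʳ (R.zeroˡ _)) (R.trans (R.+-identityˡ _)
    (R.trans (*-cong {tail X} {1#} {f} {f} (λ { zero → R.refl ; (suc _) → R.refl }) (λ _ → R.refl) k) (*-identityˡ f k)))

  *-unital : ∀ f g → f 0 R.≈ R.1# → g 0 R.≈ R.1# → (f * g) 0 R.≈ R.1#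
  *-unital f g f₀ g₀ =
    R.trans (R.+-identityʳ _) (R.trans (R.*-cong f₀ g₀) (R.*-identityˡ _))

  ^-unital : ∀ f n → f 0 R.≈ R.1# → (f ^ n) 0 R.≈ R.1#
  ^-unital f zero    f₀ = R.refl
  ^-unital f (suc n) f₀ = *-unital f (f ^ n) f₀ (^-unital f n f₀)

  -- Reduces a quotient to a product identity, so that the recursion defining `inverse` never has to
  -- be unfolded.
  /-unique : ∀ f d g → d 0 R.≈ R.1# → g * d ≈ f → f / d ≈ g
  /-unique f d g d₀ gd≈f =
    trans (*-congʳ {inverse d} (sym gd≈f))
      (trans (*-assoc g d (inverse d))
        (trans (*-congˡ {g} (*-inverseʳ R.ring d d₀)) (*-identityʳ g)))

  const-homo-* : ∀ a b → const (a R.* b) ≈ const a * const b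
  const-homo-* a b zero    = R.sym (const-* a (const b) zero)
  const-homo-* a b (suc k) = R.sym (R.trans (const-* a (const b) (suc k)) (R.zeroʳ _))


-- Coefficient lists inherit the ring laws from power series along `coeff`, which is injective
-- because equality of lists is by definition equality of coefficients.
module PolynomialRing (R : CommutativeRing c ℓ) where
  private
    module R = CommutativeRing R
    module S = PowerSeries R.rawRing
    module P = CommutativeRing (SeriesRing.commutativeRing R)
    open Polynomial R.rawRing

    coeff-+ : ∀ f g → coeff (f + g) S.≈ coeff f S.+ coeff g
    coeff-+ []      g       k       = R.sym (R.+-identityˡ _)
    coeff-+ (a ∷ f) []      k       = R.sym (R.+-identityʳ _)
    coeff-+ (a ∷ f) (b ∷ g) zero    = R.refl
    coeff-+ (a ∷ f) (b ∷ g) (suc k) = coeff-+ f g k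

    coeff-neg : ∀ f → coeff (- f) S.≈ S.- coeff f
    coeff-neg []      k       = R.sym (RingProperties.-0#≈0# R.ring)
    coeff-neg (a ∷ f) zero    = R.refl
    coeff-neg (a ∷ f) (suc k) = coeff-neg f k

    coeff-map : ∀ a g k → coeff (List.map (a R.*_) g) k R.≈ a R.* coeff g k
    coeff-map a []      k       = R.sym (R.zeroʳ a)
    coeff-map a (b ∷ g) zero    = R.refl
    coeff-map a (b ∷ g) (suc k) = coeff-map a g k

    coeff-* : ∀ f g → coeff (f * g) S.≈ coeff f S.* coeff g
    coeff-* []      g k       = R.sym (P.zeroˡ (coeff g) k)
    coeff-* (a ∷ f) g zero    = R.trans
      (coeff-+ (List.map (a R.*_) g) (R.0# ∷ f * g) zero)
      (R.+-congʳ (coeff-map a g zero))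
    coeff-* (a ∷ f) g (suc k) = R.trans
      (coeff-+ (List.map (a R.*_) g) (R.0# ∷ f * g) (suc k))
      (R.+-cong (coeff-map a g (suc k)) (coeff-* f g k))

    coeff-1 : coeff 1# S.≈ S.1#
    coeff-1 zero    = R.refl
    coeff-1 (suc k) = R.refl

    isRingMonomorphism : IsRingMonomorphism rawRing S.rawRing coeff
    isRingMonomorphism = record
      { isRingHomomorphism = record
        { isSemiringHomomorphism = record
          { isNearSemiringHomomorphism = record
            { +-isMonoidHomomorphism = record
              { isMagmaHomomorphism = record
                { isRelHomomorphism = record { cong = λ f≈g → f≈g }
                ; homo = coeff-+
                }
              ; ε-homo = λ _ → R.refl
              }
            ; *-homo = coeff-*
            }
          ; 1#-homo = coeff-1
          }
        ; -‿homo = coeff-neg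
        }
      ; injective = λ f≈g → f≈g
      }

  commutativeRing : CommutativeRing c ℓ
  commutativeRing = record
    { isCommutativeRing =
        RingMonomorphism.isCommutativeRing isRingMonomorphism P.isCommutativeRing }

ℤ[p]-commutativeRing : CommutativeRing _ _
ℤ[p]-commutativeRing = PolynomialRing.commutativeRing ℤ.+-*-commutativeRing

-- Sums over lists

∈-concatMap⁺′ : ∀ (g : A → List B) {xs x y} → x ∈ xs → y ∈ g x → y ∈ concatMap g xs
∈-concatMap⁺′ g x∈xs y∈gx = ∈-concatMap⁺ g (lose x∈xs y∈gx)

∈-concatMap⁻′ : ∀ (g : A → List B) xs {y} → y ∈ concatMap g xs → ∃ λ x → x ∈ xs × y ∈ g x
∈-concatMap⁻′ g xs y∈ = find (∈-concatMap⁻ g {xs} y∈)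

concatMap-unique : ∀ (g : A → List B) {xs} → Unique xs → (∀ x → Unique (g x)) →
  (∀ {x y v} → v ∈ g x → v ∈ g y → x ≡ y) → Unique (concatMap g xs)
concatMap-unique g []               g! disjoint = []
concatMap-unique g {x ∷ xs} (x∉ ∷ xs!) g! disjoint =
  Unique.++⁺ (g! x) (concatMap-unique g xs! g! disjoint) λ (v∈gx , v∈gxs) →
    let y , y∈xs , v∈gy = ∈-concatMap⁻′ g xs v∈gxs
    in All.lookup x∉ y∈xs (disjoint v∈gx v∈gy)

AllPairs-map⁺ : ∀ {R : Rel B 0ℓ} (f : A → B) {xs} →
  (∀ {x y} → x ∈ xs → y ∈ xs → x ≢ y → R (f x) (f y)) → Unique xs → AllPairs R (map f xs)
AllPairs-map⁺ f r []         = []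
AllPairs-map⁺ f r (x∉ ∷ xs!) =
  All.map⁺ (All.tabulate λ y∈ → r (here refl) (there y∈) (All.lookup x∉ y∈)) ∷
  AllPairs-map⁺ f (λ x∈ y∈ → r (there x∈) (there y∈)) xs!

-- In a duplicate-free list membership has at most one proof, so two such lists with the same
-- members are equal as bags.
map-↭ : ∀ (f : A → B) {xs ys} → Unique xs → Unique ys →
  (∀ {x y} → x ∈ xs → y ∈ xs → f x ≡ f y → x ≡ y) →
  (∀ {x} → x ∈ xs → f x ∈ ys) →
  (∀ {y} → y ∈ ys → ∃ λ x → x ∈ xs × f x ≡ y) →
  map f xs ↭ ys
map-↭ f {xs} {ys} xs! ys! inj maps surj = ∼bag⇒↭ (unique∧set⇒bag (AllPairs-map⁺ f (λ x∈ y∈ x≢y → x≢y ∘ inj x∈ y∈) xs!) ys! (mk⇔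
  (λ v∈ → let x , x∈ , v≡fx = ∈-map⁻ f v∈ in subst (_∈ ys) (≡.sym v≡fx) (maps x∈))
  (λ v∈ → let x , x∈ , fx≡v = surj v∈ in subst (_∈ map f xs) fx≡v (∈-map⁺ f x∈))))

module ListSum (M : CommutativeMonoid c ℓ) where
  open CommutativeMonoid M renaming (refl to ≈-refl; sym to ≈-sym; trans to ≈-trans)
  open CommutativeSemigroup commutativeSemigroup using (x∙yz≈y∙xz)
  open RawMonoid rawMonoid using (sum)

  ∑ˡ : List A → (A → Carrier) → Carrier
  ∑ˡ xs f = List.foldr _∙_ ε (map f xs)

  ∑ˡ-cong : ∀ {f g : A → Carrier} xs → (∀ {x} → x ∈ xs → f x ≈ g x) → ∑ˡ xs f ≈ ∑ˡ xs g
  ∑ˡ-cong []       f≈g = ≈-refl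
  ∑ˡ-cong (x ∷ xs) f≈g = ∙-cong (f≈g (here refl)) (∑ˡ-cong xs (f≈g ∘ there))

  ∑ˡ-++ : ∀ (f : A → Carrier) xs ys → ∑ˡ (xs ++ ys) f ≈ ∑ˡ xs f ∙ ∑ˡ ys f
  ∑ˡ-++ f []       ys = ≈-sym (identityˡ _)
  ∑ˡ-++ f (x ∷ xs) ys = ≈-trans (∙-congˡ (∑ˡ-++ f xs ys)) (≈-sym (assoc _ _ _))

  ∑ˡ-map : ∀ (f : B → Carrier) (g : A → B) xs → ∑ˡ (map g xs) f ≡ ∑ˡ xs (f ∘ g)
  ∑ˡ-map f g []       = refl
  ∑ˡ-map f g (x ∷ xs) = cong (f (g x) ∙_) (∑ˡ-map f g xs)

  ∑ˡ-concatMap : ∀ (f : B → Carrier) (g : A → List B) xs →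
    ∑ˡ (concatMap g xs) f ≈ ∑ˡ xs (λ x → ∑ˡ (g x) f)
  ∑ˡ-concatMap f g []       = ≈-refl
  ∑ˡ-concatMap f g (x ∷ xs) =
    ≈-trans (∑ˡ-++ f (g x) (concatMap g xs)) (∙-congˡ (∑ˡ-concatMap f g xs))

  ∑ˡ-tabulate : ∀ {n} (f : A → Carrier) (g : Fin n → A) → ∑ˡ (List.tabulate g) f ≡ sum (f ∘ g)
  ∑ˡ-tabulate {n = zero}  f g = refl
  ∑ˡ-tabulate {n = suc n} f g = cong (f (g zero) ∙_) (∑ˡ-tabulate f (g ∘ suc))

  ∑ˡ-↭ : ∀ (f : A → Carrier) {xs ys} → xs ↭ ys → ∑ˡ xs f ≈ ∑ˡ ys f
  ∑ˡ-↭ f ↭.refl           = ≈-refl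
  ∑ˡ-↭ f (↭.prep x p)     = ∙-congˡ (∑ˡ-↭ f p)
  ∑ˡ-↭ f (↭.swap x y p)   = ≈-trans (x∙yz≈y∙xz _ _ _) (∙-congˡ (∙-congˡ (∑ˡ-↭ f p)))
  ∑ˡ-↭ f (↭.trans p q)    = ≈-trans (∑ˡ-↭ f p) (∑ˡ-↭ f q)

  ∑ˡ-bijection : ∀ (f : A → B) {xs ys} (v : A → Carrier) (w : B → Carrier) →
    Unique xs → Unique ys →
    (∀ {x y} → x ∈ xs → y ∈ xs → f x ≡ f y → x ≡ y) →
    (∀ {x} → x ∈ xs → f x ∈ ys) →
    (∀ {y} → y ∈ ys → ∃ λ x → x ∈ xs × f x ≡ y) →
    (∀ {x} → x ∈ xs → v x ≈ w (f x)) →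
    ∑ˡ xs v ≈ ∑ˡ ys w
  ∑ˡ-bijection f {xs} v w xs! ys! inj maps surj v≈w =
    ≈-trans (∑ˡ-cong xs v≈w)
      (≈-trans (reflexive (≡.sym (∑ˡ-map w f xs)))
        (∑ˡ-↭ w (map-↭ f xs! ys! inj maps surj)))

-- Lexicographic chains and descents

ι : ∀ {P : Set} → Dec P → ℕ
ι d = if does d then 1 else 0

count-tabulate : ∀ {P : A → Set} (P? : ∀ x → Dec (P x)) {n} (f : Fin n → A) →
  Vec.count P? (Vec.tabulate f) ≡ ∑ (λ i → ι (P? (f i)))
count-tabulate P? {zero}  f = refl
count-tabulate P? {suc n} f with P? (f zero)
... | yes _ = cong suc (count-tabulate P? (f ∘ suc))
... | no  _ = count-tabulate P? (f ∘ suc)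

-- Chain a u ws fs says that (a , u) , (f₁ , w₁) , … , (f_k , w_k) increases
-- lexicographically.
Step : ∀ {b} → Fin b → ℤ → Fin b → ℤ → Set
Step a u f w = a Fin.≤ f × (w ℤ.< u → a Fin.< f)

Chain : ∀ {k b} → Fin b → ℤ → Vec ℤ k → Vec (Fin b) k → Set
Chain a u []       []       = ⊤
Chain a u (w ∷ ws) (f ∷ fs) = Step a u f w × Chain f w ws fs

-- A descent from u to x makes one of the two steps descend: either x < w, or w ≤ x < u.
Step-trans : ∀ {b} {a f g : Fin b} {u w x} → Step a u f w → Step f w g x → Step a u g x
Step-trans {u = u} {w} {x} (a≤f , sf) (f≤g , sg) = ℕ.≤-trans a≤f f≤g , λ x<u → strict x<u
  where
  strict : x ℤ.< u → _
  strict x<u with x ℤ.<? w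
  ... | yes x<w = ℕ.≤-<-trans a≤f (sg x<w)
  ... | no  x≮w = ℕ.<-≤-trans (sf (ℤ.≤-<-trans (ℤ.≮⇒≥ x≮w) x<u)) f≤g

Chain⇒Step : ∀ {k b} {a : Fin b} {u} (ws : Vec ℤ k) fs → Chain a u ws fs →
  ∀ i → Step a u (lookup fs i) (lookup ws i)
Chain⇒Step (w ∷ ws) (f ∷ fs) (s , ch) zero    = s
Chain⇒Step (w ∷ ws) (f ∷ fs) (s , ch) (suc i) = Step-trans s (Chain⇒Step ws fs ch i)

Chain⇒Steps : ∀ {k b} {a : Fin b} {u} (ws : Vec ℤ k) fs → Chain a u ws fs →
  ∀ {i j} → i Fin.< j → Step (lookup fs i) (lookup ws i) (lookup fs j) (lookup ws j)
Chain⇒Steps (w ∷ ws) (f ∷ fs) (s , ch) {zero}  {suc j} i<j = Chain⇒Step ws fs ch j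
Chain⇒Steps (w ∷ ws) (f ∷ fs) (s , ch) {suc i} {suc j} i<j = Chain⇒Steps ws fs ch (s<s⁻¹ i<j)

Steps⇒Chain : ∀ {k b} {a : Fin b} {u} (ws : Vec ℤ k) fs →
  (∀ i → Step a u (lookup fs i) (lookup ws i)) →
  (∀ {i j} → i Fin.< j → Step (lookup fs i) (lookup ws i) (lookup fs j) (lookup ws j)) →
  Chain a u ws fs
Steps⇒Chain []       []       s ss = tt
Steps⇒Chain (w ∷ ws) (f ∷ fs) s ss =
  s zero , Steps⇒Chain ws fs (λ i → ss {zero} {suc i} z<s) (λ i<j → ss (s<s i<j))

Chain-suc⁺ : ∀ {k b} {a : Fin b} {u} (ws : Vec ℤ k) fs →
  Chain a u ws fs → Chain (suc a) u ws (Vec.map suc fs)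
Chain-suc⁺ []       []       ch               = tt
Chain-suc⁺ (w ∷ ws) (f ∷ fs) ((a≤f , s) , ch) = (s≤s a≤f , s<s ∘ s) , Chain-suc⁺ ws fs ch

-- Blocks never decrease along a chain, so none of them is zero and all can be lowered by one.
Chain-suc⁻ : ∀ {k b} {a : Fin b} {u} (ws : Vec ℤ k) fs → Chain (suc a) u ws fs →
  ∃ λ fs′ → Vec.map suc fs′ ≡ fs × Chain a u ws fs′
Chain-suc⁻ []       []           ch               = [] , refl , tt
Chain-suc⁻ (w ∷ ws) (zero  ∷ fs) ((() , _) , _)
Chain-suc⁻ (w ∷ ws) (suc f ∷ fs) ((a≤f , s) , ch) =
  let fs′ , eq , ch′ = Chain-suc⁻ ws fs ch
  in f ∷ fs′ , cong (suc f ∷_) eq , (s≤s⁻¹ a≤f , s<s⁻¹ ∘ s) , ch′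

-- The first block is either zero or can be lowered together with all the others and with m. The
-- enumeration follows this alternative, so that the generating functions in m satisfy weak = chains
-- + t weak and strict = t weak.
chains : ∀ {k} → ℤ → Vec ℤ k → ∀ m → List (Vec (Fin (suc m)) k)
weakChains : ∀ {k} → ℤ → Vec ℤ k → ∀ m → List (Vec (Fin (suc m)) (suc k))
strictChains : ∀ {k} → ℤ → Vec ℤ k → ∀ m → List (Vec (Fin (suc m)) (suc k))

chains u []       m = [] ∷ []
chains u (w ∷ ws) m with w ℤ.<? u
... | yes _ = strictChains w ws m
... | no  _ = weakChains w ws m

weakChains w ws zero    = map (zero ∷_) (chains w ws zero)
weakChains w ws (suc m) =
  map (zero ∷_) (chains w ws (suc m)) ++ map (Vec.map suc) (weakChains w ws m)

strictChains w ws zero    = []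
strictChains w ws (suc m) = map (Vec.map suc) (weakChains w ws m)

∈-chains⁺ : ∀ {k} u (ws : Vec ℤ k) {m fs} → Chain zero u ws fs → fs ∈ chains u ws m
∈-weakChains⁺ : ∀ {k} w (ws : Vec ℤ k) {m f fs} →
  Chain f w ws fs → (f ∷ fs) ∈ weakChains w ws m
∈-strictChains⁺ : ∀ {k} w (ws : Vec ℤ k) {m f fs} →
  zero {m} Fin.< f → Chain f w ws fs → (f ∷ fs) ∈ strictChains w ws m

∈-chains⁺ u []       {fs = []}     ch = here refl
∈-chains⁺ u (w ∷ ws) {fs = f ∷ fs} ((_ , s) , ch) with w ℤ.<? u
... | yes w<u = ∈-strictChains⁺ w ws (s w<u) ch
... | no  _   = ∈-weakChains⁺ w ws ch

∈-weakChains⁺ w ws {zero}  {zero}  ch = ∈-map⁺ (zero ∷_) (∈-chains⁺ w ws ch)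
∈-weakChains⁺ w ws {suc m} {zero}  ch = ∈-++⁺ˡ (∈-map⁺ (zero ∷_) (∈-chains⁺ w ws ch))
∈-weakChains⁺ w ws {suc m} {suc f} {fs} ch with Chain-suc⁻ ws fs ch
... | fs′ , refl , ch′ = ∈-++⁺ʳ _ (∈-map⁺ (Vec.map suc) (∈-weakChains⁺ w ws ch′))

∈-strictChains⁺ w ws {zero}  {zero}  () ch
∈-strictChains⁺ w ws {suc m} {zero}  () ch
∈-strictChains⁺ w ws {suc m} {suc f} {fs} 0<f ch with Chain-suc⁻ ws fs ch
... | fs′ , refl , ch′ = ∈-map⁺ (Vec.map suc) (∈-weakChains⁺ w ws ch′)

∈-chains⁻ : ∀ {k} u (ws : Vec ℤ k) {m fs} → fs ∈ chains u ws m → Chain zero u ws fs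
∈-weakChains⁻ : ∀ {k} w (ws : Vec ℤ k) {m f fs} →
  (f ∷ fs) ∈ weakChains w ws m → Chain f w ws fs
∈-strictChains⁻ : ∀ {k} w (ws : Vec ℤ k) {m f fs} →
  (f ∷ fs) ∈ strictChains w ws m → zero {m} Fin.< f × Chain f w ws fs

∈-chains⁻ u []       {fs = []}     _ = tt
∈-chains⁻ u (w ∷ ws) {fs = f ∷ fs} f∈ with w ℤ.<? u
... | yes _   = let 0<f , ch = ∈-strictChains⁻ w ws f∈ in (z≤n , λ _ → 0<f) , ch
... | no  w≮u = (z≤n , λ w<u → contradiction w<u w≮u) , ∈-weakChains⁻ w ws f∈

∈-weakChains⁻ w ws {zero} f∈ with ∈-map⁻ (zero ∷_) f∈
... | fs , fs∈ , refl = ∈-chains⁻ w ws fs∈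
∈-weakChains⁻ w ws {suc m} f∈ with ∈-++⁻ (map (zero ∷_) (chains w ws (suc m))) f∈
... | inj₁ f∈₁ with ∈-map⁻ (zero ∷_) f∈₁
...   | fs , fs∈ , refl = ∈-chains⁻ w ws fs∈
∈-weakChains⁻ w ws {suc m} f∈ | inj₂ f∈₂ with ∈-map⁻ (Vec.map suc) f∈₂
...   | f ∷ fs , fs∈ , refl = Chain-suc⁺ ws fs (∈-weakChains⁻ w ws fs∈)

∈-strictChains⁻ w ws {suc m} f∈ with ∈-map⁻ (Vec.map suc) f∈
... | f ∷ fs , fs∈ , refl = z<s , Chain-suc⁺ ws fs (∈-weakChains⁻ w ws fs∈)

map-suc-injective : ∀ {k b} {fs gs : Vec (Fin b) k} → Vec.map Fin.suc fs ≡ Vec.map Fin.suc gs → fs ≡ gs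
map-suc-injective {fs = []}     {[]}     eq = refl
map-suc-injective {fs = f ∷ fs} {g ∷ gs} eq =
  cong₂ _∷_ (Fin.suc-injective (Vec.∷-injectiveˡ eq)) (map-suc-injective (Vec.∷-injectiveʳ eq))

chains-unique : ∀ {k} u (ws : Vec ℤ k) m → Unique (chains u ws m)
weakChains-unique : ∀ {k} w (ws : Vec ℤ k) m → Unique (weakChains w ws m)

chains-unique u []       m = [] ∷ []
chains-unique u (w ∷ ws) m with w ℤ.<? u
chains-unique u (w ∷ ws) zero    | yes _ = []
chains-unique u (w ∷ ws) (suc m) | yes _ = Unique.map⁺ map-suc-injective (weakChains-unique w ws m)
... | no  _ = weakChains-unique w ws m

weakChains-unique w ws zero    = Unique.map⁺ Vec.∷-injectiveʳ (chains-unique w ws zero)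
weakChains-unique w ws (suc m) = Unique.++⁺
  (Unique.map⁺ Vec.∷-injectiveʳ (chains-unique w ws (suc m)))
  (Unique.map⁺ map-suc-injective (weakChains-unique w ws m))
  λ (v∈₁ , v∈₂) → disjoint (∈-map⁻ (zero ∷_) v∈₁) (∈-map⁻ (Vec.map suc) v∈₂)
  where
  disjoint : ∀ {v} → (∃ λ fs → fs ∈ chains w ws (suc m) × v ≡ zero ∷ fs) →
    (∃ λ gs → gs ∈ weakChains w ws m × v ≡ Vec.map suc gs) → _
  disjoint (_ , _ , refl) (_ ∷ _ , _ , ())

descents : ∀ {k} → ℤ → Vec ℤ k → ℕ
descents u []       = 0
descents u (w ∷ ws) = ι (w ℤ.<? u) ℕ.+ descents w ws

descents≡∑ : ∀ {k} u (ws : Vec ℤ k) →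
  ∑ (λ i → ι (lookup (u ∷ ws) (suc i) ℤ.<? lookup (u ∷ ws) (inject₁ i))) ≡ descents u ws
descents≡∑ u []       = refl
descents≡∑ u (w ∷ ws) = cong (ι (w ℤ.<? u) ℕ.+_) (descents≡∑ w ws)

desᴮ≡descents : ∀ {n} (π : Word n) → desᴮ π ≡ descents 0ℤ (Vec.map toℤ π)
desᴮ≡descents π = ≡.trans
  (count-tabulate (λ i → lookup w (suc i) ℤ.<? lookup w (inject₁ i)) id)
  (descents≡∑ 0ℤ (Vec.map toℤ π))
  where w = 0ℤ ∷ Vec.map toℤ π

-- Generating functions of chains in t

module Geometric (R : CommutativeRing c ℓ) where
  open CommutativeRing R hiding (zero; refl)
  open RingProperties ring using (-‿distribˡ-*)
  open CommutativeSemigroup +-commutativeSemigroup using (xy∙z≈xz∙y)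
  open SetoidReasoning setoid

  -- Turns a coefficient recursion into a product identity, so 1 - x need not be inverted.
  geometric : ∀ {f g} x → f ≈ g + x * f → (1# - x) * f ≈ g
  geometric {f} {g} x f≈g+xf = begin
    (1# - x) * f                ≈⟨ distribʳ f 1# (- x) ⟩
    1# * f + - x * f            ≈⟨ +-cong (*-identityˡ f) (sym (-‿distribˡ-* x f)) ⟩
    f - x * f                   ≈⟨ +-congʳ f≈g+xf ⟩
    (g + x * f) - x * f         ≈⟨ +-assoc g (x * f) (- (x * f)) ⟩
    g + (x * f - x * f)         ≈⟨ +-congˡ (-‿inverseʳ (x * f)) ⟩
    g + 0#                      ≈⟨ +-identityʳ g ⟩
    g                           ∎

-- Here `X` is t, its exponent m bounds the blocks, and `y` is the power of p belonging to a fixed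
-- word.
module ChainSeries (R : CommutativeRing c ℓ) (y : CommutativeRing.Carrier R) where
  private
    module R = CommutativeRing R
  open SeriesRing R using (commutativeRing; X*-zero; X*-suc)
  open CommutativeRing commutativeRing hiding (zero) renaming (refl to ≈-refl)
  open PowerSeries R.rawRing using (X; const; _^_)
  open ListSum R.+-commutativeMonoid
  open Geometric commutativeRing
  open CommutativeSemigroup *-commutativeSemigroup using (x∙yz≈y∙xz)
  open SetoidReasoning setoid

  series weakSeries strictSeries : ∀ {k} → ℤ → Vec ℤ k → Carrier
  series       u ws m = ∑ˡ (chains u ws m) (λ _ → y)
  weakSeries   w ws m = ∑ˡ (weakChains w ws m) (λ _ → y)
  strictSeries w ws m = ∑ˡ (strictChains w ws m) (λ _ → y)

  -- There is one empty chain for every m. This yields the one factor 1 - t in excess of the number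
  -- of letters.
  series-[] : ∀ u → (1# - X) * series u [] ≈ const y
  series-[] u = geometric X λ
    { zero    → R.+-congˡ (R.sym (X*-zero (series u [])))
    ; (suc m) → R.trans (R.+-identityʳ y) (R.sym (R.trans (R.+-identityˡ _)
                  (R.trans (X*-suc (series u []) m) (R.+-identityʳ y))))
    }

  weakSeries≈ : ∀ {k} w (ws : Vec ℤ k) → (1# - X) * weakSeries w ws ≈ series w ws
  weakSeries≈ w ws = geometric X λ
    { zero    → R.trans
        (R.reflexive (∑ˡ-map (λ _ → y) (zero ∷_) (chains w ws zero)))
        (R.sym (R.trans (R.+-congˡ (X*-zero (weakSeries w ws))) (R.+-identityʳ _)))
    ; (suc m) → R.trans (∑ˡ-++ (λ _ → y) (map (zero ∷_) (chains w ws (suc m))) _) (R.+-cong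
        (R.reflexive (∑ˡ-map (λ _ → y) (zero ∷_) (chains w ws (suc m))))
        (R.trans (R.reflexive (∑ˡ-map (λ _ → y) (Vec.map suc) (weakChains w ws m)))
          (R.sym (X*-suc (weakSeries w ws) m))))
    }

  strictSeries≈ : ∀ {k} w (ws : Vec ℤ k) → strictSeries w ws ≈ X * weakSeries w ws
  strictSeries≈ w ws zero    = R.sym (X*-zero (weakSeries w ws))
  strictSeries≈ w ws (suc m) =
    R.trans (R.reflexive (∑ˡ-map (λ _ → y) (Vec.map suc) (weakChains w ws m)))
      (R.sym (X*-suc (weakSeries w ws) m))

  -- Choosing the first block costs one factor 1 / (1 - t); a descent rules out block zero and
  -- shifts the count by t.
  series-∷ : ∀ {k} u w (ws : Vec ℤ k) →
    (1# - X) * series u (w ∷ ws) ≈ X ^ ι (w ℤ.<? u) * series w ws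
  series-∷ u w ws with w ℤ.<? u
  ... | yes _ = begin
    (1# - X) * strictSeries w ws        ≈⟨ *-congˡ {1# - X} (strictSeries≈ w ws) ⟩
    (1# - X) * (X * weakSeries w ws)    ≈⟨ x∙yz≈y∙xz (1# - X) X (weakSeries w ws) ⟩
    X * ((1# - X) * weakSeries w ws)    ≈⟨ *-cong (sym (*-identityʳ X)) (weakSeries≈ w ws) ⟩
    X * 1# * series w ws                ∎
  ... | no  _ = begin
    (1# - X) * weakSeries w ws          ≈⟨ weakSeries≈ w ws ⟩
    series w ws                         ≈⟨ *-identityˡ (series w ws) ⟨
    1# * series w ws                    ∎

  series≈ : ∀ {k} u (ws : Vec ℤ k) →
    (1# - X) ^ suc k * series u ws ≈ const y * X ^ descents u ws
  series≈ u [] = begin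
    (1# - X) * 1# * series u []     ≈⟨ *-congʳ {series u []} (*-identityʳ (1# - X)) ⟩
    (1# - X) * series u []          ≈⟨ series-[] u ⟩
    const y                         ≈⟨ *-identityʳ (const y) ⟨
    const y * 1#                    ∎
  series≈ {suc k} u (w ∷ ws) = begin
    (1# - X) * D * series u (w ∷ ws)    ≈⟨ *-congʳ {series u (w ∷ ws)} (*-comm (1# - X) D) ⟩
    D * (1# - X) * series u (w ∷ ws)    ≈⟨ *-assoc D (1# - X) (series u (w ∷ ws)) ⟩
    D * ((1# - X) * series u (w ∷ ws))  ≈⟨ *-congˡ {D} (series-∷ u w ws) ⟩
    D * (X ^ δ * series w ws)           ≈⟨ x∙yz≈y∙xz D (X ^ δ) (series w ws) ⟩
    X ^ δ * (D * series w ws)           ≈⟨ *-congˡ {X ^ δ} (series≈ w ws) ⟩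
    X ^ δ * (const y * X ^ d)           ≈⟨ x∙yz≈y∙xz (X ^ δ) (const y) (X ^ d) ⟩
    const y * (X ^ δ * X ^ d)           ≈⟨ *-congˡ {const y} (X^-+ δ) ⟨
    const y * X ^ (δ ℕ.+ d)             ∎
    where
    D = (1# - X) ^ suc k
    δ = ι (w ℤ.<? u)
    d = descents w ws
    X^-+ : ∀ i → X ^ (i ℕ.+ d) ≈ X ^ i * X ^ d
    X^-+ zero    = sym (*-identityˡ (X ^ d))
    X^-+ (suc i) = trans (*-congˡ {X} (X^-+ i)) (sym (*-assoc X (X ^ i) (X ^ d)))

module SeriesSum (R : CommutativeRing c ℓ) where
  private
    module R = CommutativeRing R
  open SeriesRing R using (commutativeRing)
  open CommutativeRing commutativeRing hiding (zero) renaming (refl to ≈-refl)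
  open ListSum +-commutativeMonoid
  module Coeff = ListSum R.+-commutativeMonoid

  ∑ˡ-coeff : ∀ {A : Set} (xs : List A) (F : A → Carrier) k →
    ∑ˡ xs F k ≡ Coeff.∑ˡ xs (λ x → F x k)
  ∑ˡ-coeff []       F k = refl
  ∑ˡ-coeff (x ∷ xs) F k = cong (F x k R.+_) (∑ˡ-coeff xs F k)

*-distribˡ-∑ˡ : ∀ (R : CommutativeRing c ℓ) → let open CommutativeRing R; open ListSum +-commutativeMonoid in
  ∀ {A : Set} d (xs : List A) F → d * ∑ˡ xs F ≈ ∑ˡ xs (λ x → d * F x)
*-distribˡ-∑ˡ R d []       F = CommutativeRing.zeroʳ R d
*-distribˡ-∑ˡ R d (x ∷ xs) F =
  let open CommutativeRing R in trans (distribˡ d (F x) _) (+-congˡ (*-distribˡ-∑ˡ R d xs F))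


module DescentSeries (R : CommutativeRing c ℓ) where
  private
    module R = CommutativeRing R
  open SeriesRing R using (commutativeRing; /-unique; ^-unital)
  open CommutativeRing commutativeRing hiding (zero) renaming (refl to ≈-refl)
  open PowerSeries R.rawRing using (X; const; _^_; _/_)
  open ListSum R.+-commutativeMonoid using () renaming (∑ˡ to ∑ᴿ)
  open ListSum +-commutativeMonoid
  open SetoidReasoning setoid

  -- The sum of the chain series is the candidate for the quotient, and `/-unique` leaves only a
  -- multiplication by (1 - t)^(n+1) to check, word by word.
  descentSeries : ∀ {n} (πs : List (Word n)) (y : Word n → R.Carrier) m →
    (∑ˡ πs (λ π → const (y π) * X ^ desᴮ π) / (1# - X) ^ suc n) m R.≈
    ∑ᴿ πs (λ π → ∑ᴿ (chains 0ℤ (Vec.map toℤ π) m) (λ _ → y π))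
  descentSeries {n} πs y m = R.trans
    (/-unique f D (∑ˡ πs S) (^-unital (1# - X) (suc n) unital) SD≈f m)
    (R.reflexive (SeriesSum.∑ˡ-coeff R πs S m))
    where
    f = ∑ˡ πs (λ π → const (y π) * X ^ desᴮ π)
    D = (1# - X) ^ suc n
    S : Word n → Carrier
    S π = ChainSeries.series R (y π) 0ℤ (Vec.map toℤ π)
    unital : R.1# R.- R.0# R.≈ R.1#
    unital = R.trans (R.+-congˡ (RingProperties.-0#≈0# R.ring)) (R.+-identityʳ R.1#)
    SD≈f : ∑ˡ πs S * D ≈ f
    SD≈f = begin
      ∑ˡ πs S * D              ≈⟨ *-comm (∑ˡ πs S) D ⟩
      D * ∑ˡ πs S              ≈⟨ *-distribˡ-∑ˡ commutativeRing D πs S ⟩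
      ∑ˡ πs (λ π → D * S π)    ≈⟨ ∑ˡ-cong πs (λ {π} _ → trans
        (ChainSeries.series≈ R (y π) 0ℤ (Vec.map toℤ π))
        (reflexive (cong (λ d → const (y π) * X ^ d) (≡.sym (desᴮ≡descents π))))) ⟩
      f                        ∎

-- Multiplicities of orbits

-- The orbits of (a , s , b) ↦ (b , s , a) are of three kinds: a label (a , + , a), a
-- label (a , - , a), and two labels with a ≢ b.
data Kind : Set where
  loop⁺ loop⁻ edge : Kind

parity : ℕ → ℕ
parity zero          = 0
parity (suc zero)    = 1
parity (suc (suc k)) = parity k

-- The positions and fixed positions of an orbit whose label occurs k times. On `loop⁺` the
-- involution is the identity; on `loop⁻` it reverses the k positions and fixes the middle one if k
-- is odd; on `edge` it exchanges two classes of k positions each.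
sizeOf fixOf : Kind → ℕ → ℕ
sizeOf loop⁺ k = k
sizeOf loop⁻ k = k
sizeOf edge  k = k ℕ.+ k

fixOf loop⁺ k = k
fixOf loop⁻ k = parity k
fixOf edge  k = 0

size fixes : (rs : List (Kind × A)) → Vec ℕ (length rs) → ℕ
size []             []       = 0
size ((κ , _) ∷ rs) (k ∷ ks) = sizeOf κ k ℕ.+ size rs ks

fixes []             []       = 0
fixes ((κ , _) ∷ rs) (k ∷ ks) = fixOf κ k ℕ.+ fixes rs ks

halves : ℕ → List ℕ
halves zero          = 0 ∷ []
halves (suc zero)    = []
halves (suc (suc i)) = map suc (halves i)

-- The preimages under `sizeOf κ`, as a list of at most one element, so that sizes impossible for an
-- edge give an empty sum.
ofSize : Kind → ℕ → List ℕ
ofSize loop⁺ i = i ∷ []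
ofSize loop⁻ i = i ∷ []
ofSize edge  i = halves i

-- The size of the first orbit runs through `Fin (suc n)` exactly as the index in the product of
-- power series does, so that summing over this list is a convolution.
multiplicities : (rs : List (Kind × A)) → ℕ → List (Vec ℕ (length rs))
withFirst : (κ : Kind) (rs : List (Kind × A)) (n : ℕ) → Fin (suc n) → List (Vec ℕ (suc (length rs)))

multiplicities []             zero    = [] ∷ []
multiplicities []             (suc n) = []
multiplicities ((κ , _) ∷ rs) n       = concatMap (withFirst κ rs n) (allFin (suc n))

withFirst κ rs n i =
  cartesianProductWith _∷_ (ofSize κ (toℕ i)) (multiplicities rs (n ∸ toℕ i))

∈-halves⁺ : ∀ k → k ∈ halves (k ℕ.+ k)
∈-halves⁺ zero    = here refl
∈-halves⁺ (suc k) rewrite ℕ.+-suc k k = ∈-map⁺ suc (∈-halves⁺ k)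

∈-halves⁻ : ∀ {k} i → k ∈ halves i → k ℕ.+ k ≡ i
∈-halves⁻ zero          (here refl) = refl
∈-halves⁻ (suc (suc i)) k∈ with ∈-map⁻ suc k∈
... | k , k∈′ , refl = cong suc (≡.trans (ℕ.+-suc k k) (cong suc (∈-halves⁻ i k∈′)))

halves-unique : ∀ i → Unique (halves i)
halves-unique zero          = [] ∷ []
halves-unique (suc zero)    = []
halves-unique (suc (suc i)) = Unique.map⁺ ℕ.suc-injective (halves-unique i)

∈-ofSize⁺ : ∀ κ k → k ∈ ofSize κ (sizeOf κ k)
∈-ofSize⁺ loop⁺ k = here refl
∈-ofSize⁺ loop⁻ k = here refl
∈-ofSize⁺ edge  k = ∈-halves⁺ k

∈-ofSize⁻ : ∀ κ {k i} → k ∈ ofSize κ i → sizeOf κ k ≡ i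
∈-ofSize⁻ loop⁺     (here refl) = refl
∈-ofSize⁻ loop⁻     (here refl) = refl
∈-ofSize⁻ edge  {i = i} k∈        = ∈-halves⁻ i k∈

ofSize-unique : ∀ κ i → Unique (ofSize κ i)
ofSize-unique loop⁺ i = [] ∷ []
ofSize-unique loop⁻ i = [] ∷ []
ofSize-unique edge  i = halves-unique i

∈-multiplicities⁺ : ∀ (rs : List (Kind × A)) ks → ks ∈ multiplicities rs (size rs ks)
∈-multiplicities⁺ []             []       = here refl
∈-multiplicities⁺ ((κ , r) ∷ rs) (k ∷ ks) =
  ∈-concatMap⁺′ (withFirst κ rs n) (∈-allFin i) (∈-cartesianProductWith⁺ _∷_
    (subst (λ l → k ∈ ofSize κ l) (≡.sym i≡s) (∈-ofSize⁺ κ k))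
    (subst (λ l → ks ∈ multiplicities rs l) (≡.sym n∸i≡) (∈-multiplicities⁺ rs ks)))
  where
  s = sizeOf κ k
  n = s ℕ.+ size rs ks
  i : Fin (suc n)
  i = Fin.fromℕ< (s≤s (ℕ.m≤m+n s (size rs ks)))
  i≡s : toℕ i ≡ s
  i≡s = Fin.toℕ-fromℕ< _
  n∸i≡ : n ∸ toℕ i ≡ size rs ks
  n∸i≡ = ≡.trans (cong (n ∸_) i≡s) (ℕ.m+n∸m≡n s (size rs ks))

∈-multiplicities⁻ : ∀ (rs : List (Kind × A)) {n ks} → ks ∈ multiplicities rs n → size rs ks ≡ n
∈-multiplicities⁻ []             {zero} {[]} _ = refl
∈-multiplicities⁻ ((κ , r) ∷ rs) {n} ks∈
  with ∈-concatMap⁻′ (withFirst κ rs n) (allFin (suc n)) ks∈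
... | i , _ , ks∈′
  with ∈-cartesianProductWith⁻ _∷_ (ofSize κ (toℕ i)) (multiplicities rs (n ∸ toℕ i)) ks∈′
... | k , ks , k∈ , ks∈″ , refl = ≡.trans
  (cong₂ ℕ._+_ (∈-ofSize⁻ κ k∈) (∈-multiplicities⁻ rs ks∈″))
  (ℕ.m+[n∸m]≡n (Fin.toℕ≤pred[n] i))

multiplicities-unique : ∀ (rs : List (Kind × A)) n → Unique (multiplicities rs n)
multiplicities-unique []             zero    = [] ∷ []
multiplicities-unique []             (suc n) = []
multiplicities-unique ((κ , r) ∷ rs) n       = concatMap-unique (withFirst κ rs n)
  (Unique.allFin⁺ (suc n))
  (λ i → Unique.cartesianProductWith⁺ _∷_ Vec.∷-injective
    (ofSize-unique κ (toℕ i)) (multiplicities-unique rs (n ∸ toℕ i)))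
  (λ {i} {j} v∈ v∈′ → Fin.toℕ-injective (disjoint i j
    (∈-cartesianProductWith⁻ _∷_ (ofSize κ (toℕ i)) (multiplicities rs (n ∸ toℕ i)) v∈)
    (∈-cartesianProductWith⁻ _∷_ (ofSize κ (toℕ j)) (multiplicities rs (n ∸ toℕ j)) v∈′)))
  where
  disjoint : ∀ i j {v} →
    (∃ λ k → ∃ λ ks → k ∈ ofSize κ (toℕ i) × ks ∈ multiplicities rs (n ∸ toℕ i) × v ≡ k ∷ ks) →
    (∃ λ k → ∃ λ ks → k ∈ ofSize κ (toℕ j) × ks ∈ multiplicities rs (n ∸ toℕ j) × v ≡ k ∷ ks) →
    toℕ i ≡ toℕ j
  disjoint i j (_ , _ , k∈ , _ , refl) (_ , _ , k∈′ , _ , refl) =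
    ≡.trans (≡.sym (∈-ofSize⁻ κ k∈)) (∈-ofSize⁻ κ k∈′)

-- Generating functions of multiplicities in z

module MultiplicitySeries (R : CommutativeRing c ℓ) (x : CommutativeRing.Carrier R) where
  private
    module R = CommutativeRing R
    module RS = SetoidReasoning R.setoid
  open SeriesRing R using (commutativeRing; const-*≈; X*-zero; X*-suc; /-unique; ^-unital; *-unital)
  open CommutativeRing commutativeRing hiding (zero; _-_) renaming (refl to ≈-refl)
  open PowerSeries R.rawRing using (X; const; _^_; _/_; _-_)
  open RawSemiring (RawRing.rawSemiring R.rawRing) using () renaming (_^_ to _^ᴿ_; sum to sumᴿ)
  open MonoidSum R.+-monoid using (sum-cong-≋)
  open ListSum R.+-commutativeMonoid
  open Geometric commutativeRing
  open CommutativeSemigroup *-commutativeSemigroup using (interchange)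
  open SetoidReasoning setoid

  ^ᴿ-+ : ∀ i j → x ^ᴿ (i ℕ.+ j) R.≈ x ^ᴿ i R.* x ^ᴿ j
  ^ᴿ-+ zero    j = R.sym (R.*-identityˡ _)
  ^ᴿ-+ (suc i) j = R.trans (R.*-congˡ (^ᴿ-+ i j)) (R.sym (R.*-assoc _ _ _))

  ^-+ : ∀ f i j → f ^ (i ℕ.+ j) ≈ f ^ i * f ^ j
  ^-+ f zero    j = sym (*-identityˡ (f ^ j))
  ^-+ f (suc i) j = trans (*-congˡ {f} (^-+ f i j)) (sym (*-assoc f (f ^ i) (f ^ j)))

  -- The factor of a single orbit. From here on `X` is z and `x` is p.
  kindSeries : Kind → Carrier
  kindSeries κ i = ∑ˡ (ofSize κ i) (λ k → x ^ᴿ fixOf κ k)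

  series : List (Kind × A) → Carrier
  series rs n = ∑ˡ (multiplicities rs n) (λ ks → x ^ᴿ fixes rs ks)

  series-[] : series {A} [] ≈ 1#
  series-[] zero    = R.+-identityʳ R.1#
  series-[] (suc n) = R.refl

  ∑ˡ-product : ∀ κ (r : A) rs ls vs →
    ∑ˡ (cartesianProductWith _∷_ ls vs) (λ ks → x ^ᴿ fixes ((κ , r) ∷ rs) ks) R.≈
    ∑ˡ ls (λ k → x ^ᴿ fixOf κ k) R.* ∑ˡ vs (λ ks → x ^ᴿ fixes rs ks)
  ∑ˡ-product κ r rs []       vs = R.sym (R.zeroˡ _)
  ∑ˡ-product κ r rs (l ∷ ls) vs = RS.begin
    ∑ˡ (map (l ∷_) vs ++ cartesianProductWith _∷_ ls vs) f
      RS.≈⟨ ∑ˡ-++ f (map (l ∷_) vs) (cartesianProductWith _∷_ ls vs) ⟩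
    ∑ˡ (map (l ∷_) vs) f R.+ ∑ˡ (cartesianProductWith _∷_ ls vs) f
      RS.≈⟨ R.+-cong (R.reflexive (∑ˡ-map f (l ∷_) vs)) (∑ˡ-product κ r rs ls vs) ⟩
    ∑ˡ vs (λ ks → x ^ᴿ (fixOf κ l ℕ.+ fixes rs ks)) R.+ ∑ˡ ls g R.* ∑ˡ vs h
      RS.≈⟨ R.+-congʳ (∑ˡ-cong vs (λ {ks} _ → ^ᴿ-+ (fixOf κ l) (fixes rs ks))) ⟩
    ∑ˡ vs (λ ks → g l R.* h ks) R.+ ∑ˡ ls g R.* ∑ˡ vs h
      RS.≈⟨ R.+-congʳ (*-distribˡ-∑ˡ R (g l) vs h) ⟨
    g l R.* ∑ˡ vs h R.+ ∑ˡ ls g R.* ∑ˡ vs h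
      RS.≈⟨ R.distribʳ _ _ _ ⟨
    (g l R.+ ∑ˡ ls g) R.* ∑ˡ vs h RS.∎
    where
    f = λ ks → x ^ᴿ fixes ((κ , r) ∷ rs) ks
    g = λ k → x ^ᴿ fixOf κ k
    h = λ ks → x ^ᴿ fixes rs ks

  series-∷ : ∀ κ (r : A) rs → series ((κ , r) ∷ rs) ≈ kindSeries κ * series rs
  series-∷ κ r rs n = R.trans
    (∑ˡ-concatMap f (withFirst κ rs n) (allFin (suc n)))
    (R.trans (R.reflexive (∑ˡ-tabulate (λ i → ∑ˡ (withFirst κ rs n i) f) id))
      (sum-cong-≋ {suc n} (λ i →
        ∑ˡ-product κ r rs (ofSize κ (toℕ i)) (multiplicities rs (n ∸ toℕ i)))))
    where f = λ ks → x ^ᴿ fixes ((κ , r) ∷ rs) ks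

  denominator numerator : Kind → Carrier
  denominator loop⁺ = 1# - const x * X
  denominator loop⁻ = 1# - X ^ 2
  denominator edge  = 1# - X ^ 2
  numerator loop⁺ = 1#
  numerator loop⁻ = 1# + const x * X
  numerator edge  = 1#

  aX*-zero : ∀ a f → ((const a * X) * f) 0 R.≈ R.0#
  aX*-zero a f = R.trans (*-assoc (const a) X f 0) (R.trans (const-*≈ a (X * f) 0)
    (R.trans (R.*-congˡ (X*-zero f)) (R.zeroʳ a)))

  aX*-suc : ∀ a f k → ((const a * X) * f) (suc k) R.≈ a R.* f k
  aX*-suc a f k = R.trans (*-assoc (const a) X f (suc k)) (R.trans (const-*≈ a (X * f) (suc k))
    (R.*-congˡ (X*-suc f k)))

  X²*-zero : ∀ f → (X ^ 2 * f) 0 R.≈ R.0#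
  X²*-zero f = R.trans (*-assoc X (X ^ 1) f 0) (X*-zero (X ^ 1 * f))

  X²*-one : ∀ f → (X ^ 2 * f) 1 R.≈ R.0#
  X²*-one f = R.trans (*-assoc X (X ^ 1) f 1) (R.trans (X*-suc (X ^ 1 * f) 0)
    (R.trans (*-assoc X 1# f 0) (X*-zero (1# * f))))

  X²*-suc² : ∀ f k → (X ^ 2 * f) (suc (suc k)) R.≈ f k
  X²*-suc² f k = R.trans (*-assoc X (X ^ 1) f (suc (suc k))) (R.trans (X*-suc (X ^ 1 * f) (suc k))
    (R.trans (*-assoc X 1# f (suc k)) (R.trans (X*-suc (1# * f) k) (*-identityˡ f k))))

  -- `parity` and `halves` recur with step two, which gives 1 - z². The two lowest coefficients are
  -- then the numerator: 1 and x for `loop⁻`, 1 and 0 for `edge`.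
  kindSeries≈ : ∀ κ → denominator κ * kindSeries κ ≈ numerator κ
  kindSeries≈ loop⁺ = geometric (const x * X) λ
    { zero    → R.+-congˡ (R.sym (aX*-zero x (kindSeries loop⁺)))
    ; (suc k) → R.trans (R.+-identityʳ _) (R.sym (R.trans (R.+-identityˡ _)
        (R.trans (aX*-suc x (kindSeries loop⁺) k) (R.*-congˡ (R.+-identityʳ _)))))
    }
  kindSeries≈ loop⁻ = geometric (X ^ 2) λ
    { zero          → R.sym (R.trans (R.+-cong
        (R.trans (R.+-congˡ (R.trans (const-*≈ x X 0) (R.zeroʳ x))) (R.+-identityʳ R.1#))
        (X²*-zero (kindSeries loop⁻))) R.refl)
    ; (suc zero)    → R.sym (R.+-cong
        (R.trans (R.+-identityˡ _) (const-*≈ x X 1))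
        (X²*-one (kindSeries loop⁻)))
    ; (suc (suc k)) → R.sym (R.trans (R.+-cong
        (R.trans (R.+-identityˡ _) (R.trans (const-*≈ x X (2 ℕ.+ k)) (R.zeroʳ x)))
        (X²*-suc² (kindSeries loop⁻) k)) (R.+-identityˡ _))
    }
  kindSeries≈ edge = geometric (X ^ 2) λ
    { zero          → R.sym (R.+-congˡ (X²*-zero (kindSeries edge)))
    ; (suc zero)    → R.sym (R.trans (R.+-identityˡ _) (X²*-one (kindSeries edge)))
    ; (suc (suc k)) → R.trans (R.reflexive (∑ˡ-map (λ _ → R.1#) suc (halves k)))
        (R.sym (R.trans (R.+-identityˡ _) (X²*-suc² (kindSeries edge) k)))
    }

  ∏ : (Kind → Carrier) → List Kind → Carrier
  ∏ F []       = 1#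
  ∏ F (κ ∷ κs) = F κ * ∏ F κs

  series*∏ : ∀ (rs : List (Kind × A)) →
    ∏ denominator (map proj₁ rs) * series rs ≈ ∏ numerator (map proj₁ rs)
  series*∏ []             = trans (*-identityˡ (series [])) series-[]
  series*∏ ((κ , r) ∷ rs) = begin
    denominator κ * D * series ((κ , r) ∷ rs)
      ≈⟨ *-congˡ {denominator κ * D} (series-∷ κ r rs) ⟩
    denominator κ * D * (kindSeries κ * series rs)
      ≈⟨ interchange (denominator κ) D (kindSeries κ) (series rs) ⟩
    denominator κ * kindSeries κ * (D * series rs)
      ≈⟨ *-cong (kindSeries≈ κ) (series*∏ rs) ⟩
    numerator κ * ∏ numerator (map proj₁ rs) ∎
    where D = ∏ denominator (map proj₁ rs)

  ∏-++ : ∀ F κs λs → ∏ F (κs ++ λs) ≈ ∏ F κs * ∏ F λs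
  ∏-++ F []       λs = sym (*-identityˡ (∏ F λs))
  ∏-++ F (κ ∷ κs) λs =
    trans (*-congˡ {F κ} (∏-++ F κs λs)) (sym (*-assoc (F κ) (∏ F κs) (∏ F λs)))

  ∏-replicate : ∀ F κ n → ∏ F (List.replicate n κ) ≈ F κ ^ n
  ∏-replicate F κ zero    = ≈-refl
  ∏-replicate F κ (suc n) = *-congˡ {F κ} (∏-replicate F κ n)

  1^ : ∀ n → 1# ^ n ≈ 1#
  1^ zero    = ≈-refl
  1^ (suc n) = trans (*-identityˡ (1# ^ n)) (1^ n)

-- Sorted labellings and compatible involutions

module _ {P : Set} where

  ι-true : (P? : Dec P) → P → ι P? ≡ 1
  ι-true (yes _) p = refl
  ι-true (no ¬p) p = contradiction p ¬p

  ι-false : (P? : Dec P) → ¬ P → ι P? ≡ 0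
  ι-false (yes p) ¬p = contradiction p ¬p
  ι-false (no _)  ¬p = refl

  ι≤1 : (P? : Dec P) → ι P? ℕ.≤ 1
  ι≤1 (yes _) = s≤s z≤n
  ι≤1 (no _)  = z≤n

ι-mono : ∀ {P Q : Set} (P? : Dec P) (Q? : Dec Q) → (P → Q) → ι P? ℕ.≤ ι Q?
ι-mono (yes p) Q? P⇒Q = ℕ.≤-reflexive (≡.sym (ι-true Q? (P⇒Q p)))
ι-mono (no _)  Q? P⇒Q = z≤n

ι-cong : ∀ {P Q : Set} (P? : Dec P) (Q? : Dec Q) → (P → Q) → (Q → P) → ι P? ≡ ι Q?
ι-cong P? Q? P⇒Q Q⇒P = ℕ.≤-antisym (ι-mono P? Q? P⇒Q) (ι-mono Q? P? Q⇒P)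

∑-zero : ∀ {n} (f : Fin n → ℕ) → (∀ i → f i ≡ 0) → ∑ f ≡ 0
∑-zero {zero}  f f≡0 = refl
∑-zero {suc n} f f≡0 = cong₂ ℕ._+_ (f≡0 zero) (∑-zero (f ∘ suc) (f≡0 ∘ suc))

∑-one : ∀ n → ∑ {n} (λ _ → 1) ≡ n
∑-one zero    = refl
∑-one (suc n) = cong suc (∑-one n)

∑-mono-≤ : ∀ {n} {f g : Fin n → ℕ} → (∀ i → f i ℕ.≤ g i) → ∑ f ℕ.≤ ∑ g
∑-mono-≤ {zero}  f≤g = z≤n
∑-mono-≤ {suc n} f≤g = ℕ.+-mono-≤ (f≤g zero) (∑-mono-≤ (f≤g ∘ suc))

∑-mono-< : ∀ {n} {f g : Fin n → ℕ} → (∀ i → f i ℕ.≤ g i) → ∀ k → f k ℕ.< g k → ∑ f ℕ.< ∑ g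
∑-mono-< f≤g zero    f<g = ℕ.+-mono-<-≤ f<g (∑-mono-≤ (f≤g ∘ suc))
∑-mono-< f≤g (suc k) f<g = ℕ.+-mono-≤-< (f≤g zero) (∑-mono-< (f≤g ∘ suc) k f<g)

∑-ι* : ∀ {M} (κ : Fin M) y → ∑ (λ μ → ι (κ Fin.≟ μ) ℕ.* y) ≡ y
∑-ι* {suc M} zero y =
  ≡.trans (cong₂ ℕ._+_ (ℕ.+-identityʳ y) (∑-zero {M} _ (λ _ → refl))) (ℕ.+-identityʳ y)
∑-ι* (suc κ) y = ∑-ι* κ y

-- Pigeonhole: if j were missed, removing it with `punchOut` would inject `Fin (suc n)` into
-- `Fin n`.
injective⇒surjective : ∀ {n} (f : Fin n → Fin n) → Injective _≡_ _≡_ f → ∀ j → ∃ λ i → f i ≡ j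
injective⇒surjective {suc n} f f-inj j with Fin.any? (λ i → f i Fin.≟ j)
... | yes i,fi≡j = i,fi≡j
... | no  ∄i     = contradiction (Fin.injective⇒≤ g-inj) ℕ.1+n≰n
  where
  j≢f : ∀ i → j ≢ f i
  j≢f i j≡fi = ∄i (i , ≡.sym j≡fi)
  g-inj : Injective _≡_ _≡_ (λ i → punchOut (j≢f i))
  g-inj {x} {y} eq = f-inj (Fin.punchOut-injective (j≢f x) (j≢f y) eq)

injective⇒permutation : ∀ {n} (f : Fin n → Fin n) → Injective _≡_ _≡_ f →
  ∃ λ (π : Permutation n n) → ∀ i → π ⟨$⟩ʳ i ≡ f i
injective⇒permutation f f-inj = Perm.permutation f (proj₁ ∘ f⁻¹) (proj₂ ∘ f⁻¹)
  (λ i → f-inj (proj₂ (f⁻¹ (f i)))) , λ _ → refl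
  where f⁻¹ = injective⇒surjective f f-inj

-- The permutation counts the smaller keys. The count is below n because a position does not count
-- itself, and injective because it grows strictly with the key.
rank : ∀ {n M} (key : Fin n → Fin M) → Injective _≡_ _≡_ key →
  ∃ λ (π : Permutation n n) → ∀ {i j} → key i Fin.< key j → (π ⟨$⟩ʳ i) Fin.< (π ⟨$⟩ʳ j)
rank {n} key key-inj =
  proj₁ perm , λ {i} {j} k<k → subst₂ Fin._<_ (≡.sym (proj₂ perm i)) (≡.sym (proj₂ perm j)) (f-mono k<k)
  where
  r : Fin n → ℕ
  r i = ∑ (λ j → ι (key j Fin.<? key i))
  r<n : ∀ i → r i ℕ.< n
  r<n i = subst (r i ℕ.<_) (∑-one n) (∑-mono-<
    (λ j → ι≤1 (key j Fin.<? key i)) i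
    (s≤s (ℕ.≤-reflexive (ι-false (key i Fin.<? key i) (ℕ.<-irrefl refl)))))
  r-mono : ∀ {i j} → key i Fin.< key j → r i ℕ.< r j
  r-mono {i} {j} k<k = ∑-mono-<
    (λ l → ι-mono (key l Fin.<? key i) (key l Fin.<? key j) (λ l<i → ℕ.<-trans l<i k<k)) i
    (subst₂ ℕ._<_ (≡.sym (ι-false (key i Fin.<? key i) (ℕ.<-irrefl refl)))
      (≡.sym (ι-true (key i Fin.<? key j) k<k)) (s≤s z≤n))
  f : Fin n → Fin n
  f i = fromℕ< (r<n i)
  f-mono : ∀ {i j} → key i Fin.< key j → f i Fin.< f j
  f-mono {i} {j} k<k =
    subst₂ ℕ._<_ (≡.sym (Fin.toℕ-fromℕ< (r<n i))) (≡.sym (Fin.toℕ-fromℕ< (r<n j))) (r-mono k<k)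
  f-inj : Injective _≡_ _≡_ f
  f-inj {i} {j} eq with Fin.<-cmp (key i) (key j)
  ... | tri< k<k _ _ = contradiction (f-mono k<k) (ℕ.<-irrefl (cong toℕ eq))
  ... | tri≈ _ k≡k _ = key-inj k≡k
  ... | tri> _ _ k>k = contradiction (f-mono k>k) (ℕ.<-irrefl (cong toℕ (≡.sym eq)))
  perm = injective⇒permutation f f-inj

Monotone : ∀ {n M} → (Fin n → Fin M) → Set
Monotone L = ∀ {i j} → i Fin.< j → L i Fin.≤ L j

multiplicity : ∀ {n M} → (Fin n → Fin M) → Fin M → ℕ
multiplicity L κ = ∑ (λ i → ι (L i Fin.≟ κ))

multiplicity-permute : ∀ {n M} (L : Fin n → Fin M) (π : Permutation n n) κ →
  multiplicity L κ ≡ multiplicity (λ i → L (π ⟨$⟩ʳ i)) κ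
multiplicity-permute L π κ = sum-permute (λ i → ι (L i Fin.≟ κ)) π

∑-multiplicity : ∀ {n M} (L : Fin n → Fin M) (w : Fin n → ℕ) →
  ∑ (λ κ → ∑ (λ i → ι (L i Fin.≟ κ) ℕ.* w i)) ≡ ∑ w
∑-multiplicity L w = ≡.trans (∑-comm (λ κ i → ι (L i Fin.≟ κ) ℕ.* w i))
  (sum-cong-≗ (λ i → ∑-ι* (L i) (w i)))

multiplicity≢0⇒∃ : ∀ {n M} (L : Fin n → Fin M) κ → multiplicity L κ ≢ 0 → ∃ λ i → L i ≡ κ
multiplicity≢0⇒∃ L κ ≢0 with Fin.any? (λ i → L i Fin.≟ κ)
... | yes i,Li≡κ = i,Li≡κ
... | no  ∄i     = contradiction
  (∑-zero _ (λ i → ι-false (L i Fin.≟ κ) (λ Li≡κ → ∄i (i , Li≡κ)))) ≢0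

∃⇒multiplicity≢0 : ∀ {n M} (L : Fin n → Fin M) i → multiplicity L (L i) ≢ 0
∃⇒multiplicity≢0 {n} L i ≡0 = ℕ.<-irrefl refl (subst₂ ℕ._<_ (∑-zero {n} _ (λ _ → refl)) ≡0
  (∑-mono-< {f = λ _ → 0} (λ _ → z≤n) i (ℕ.≤-reflexive (≡.sym (ι-true (L i Fin.≟ L i) refl)))))

-- A sorted sequence begins with its least label, and equal multiplicities make either first label
-- occur in the other sequence. So the heads agree, their share of the multiplicities cancels, and
-- induction applies to the tails.
sorted-unique : ∀ {n M} (L L′ : Fin n → Fin M) → Monotone L → Monotone L′ →
  (∀ κ → multiplicity L κ ≡ multiplicity L′ κ) → ∀ i → L i ≡ L′ i
sorted-unique {suc n} L L′ L-mono L′-mono same i = go i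
  where
  head-≤ : ∀ (F G : Fin (suc n) → Fin _) → Monotone G →
    (∀ κ → multiplicity F κ ≡ multiplicity G κ) → G zero Fin.≤ F zero
  head-≤ F G G-mono same
    with multiplicity≢0⇒∃ G (F zero) (∃⇒multiplicity≢0 F zero ∘ ≡.trans (same (F zero)))
  ... | zero  , eq = ℕ.≤-reflexive (cong toℕ eq)
  ... | suc i , eq = ℕ.≤-trans (G-mono {zero} {suc i} z<s) (ℕ.≤-reflexive (cong toℕ eq))
  head≡ : L zero ≡ L′ zero
  head≡ = Fin.≤-antisym (head-≤ L′ L L-mono (≡.sym ∘ same)) (head-≤ L L′ L′-mono same)
  go : ∀ i → L i ≡ L′ i
  go zero    = head≡
  go (suc i) = sorted-unique (L ∘ suc) (L′ ∘ suc) (L-mono ∘ s<s) (L′-mono ∘ s<s)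
    (λ κ → ℕ.+-cancelˡ-≡ (ι (L zero Fin.≟ κ)) _ _
      (≡.trans (same κ) (cong (λ μ → ι (μ Fin.≟ κ) ℕ.+ multiplicity (L′ ∘ suc) κ) (≡.sym head≡)))) i

-- Copies of label zero are put before a sorted sequence of the other labels. `prepend` replaces
-- `N zero` by a variable count to allow induction on it.
sorted-exists : ∀ {M} (N : Fin M → ℕ) →
  ∃ λ (L : Fin (∑ N) → Fin M) → Monotone L × (∀ κ → multiplicity L κ ≡ N κ)
sorted-exists {zero}  N = (λ ()) , (λ { {()} }) , λ ()
sorted-exists {suc M} N =
  let L , mono , zeros , sucs = prepend (N zero)
  in L , mono , λ { zero → zeros ; (suc κ) → sucs κ }
  where
  tail = sorted-exists (N ∘ suc)
  L′ = proj₁ tail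
  prepend : ∀ k → ∃ λ (L : Fin (k ℕ.+ ∑ (N ∘ suc)) → Fin (suc M)) → Monotone L ×
    multiplicity L zero ≡ k × (∀ κ → multiplicity L (suc κ) ≡ N (suc κ))
  prepend zero    = suc ∘ L′ , (λ i<j → s≤s (proj₁ (proj₂ tail) i<j)) ,
    ∑-zero {∑ (N ∘ suc)} _ (λ _ → refl) , proj₂ (proj₂ tail)
  prepend (suc k) = L , mono , cong suc zeros , sucs
    where
    L″ = proj₁ (prepend k)
    zeros = proj₁ (proj₂ (proj₂ (prepend k)))
    sucs = proj₂ (proj₂ (proj₂ (prepend k)))
    L : Fin (suc k ℕ.+ ∑ (N ∘ suc)) → Fin (suc M)
    L zero    = zero
    L (suc i) = L″ i
    mono : Monotone L
    mono {zero}          i<j = z≤n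
    mono {suc i} {suc j} i<j = proj₁ (proj₂ (prepend k)) (s<s⁻¹ i<j)

-- Read as labellings, π and the identity are both sorted and have the same multiplicities.
increasing-permutation : ∀ {n} (π : Permutation n n) →
  (∀ {i j} → i Fin.< j → (π ⟨$⟩ʳ i) Fin.< (π ⟨$⟩ʳ j)) → ∀ i → π ⟨$⟩ʳ i ≡ i
increasing-permutation π π-mono = sorted-unique (π ⟨$⟩ʳ_) id (ℕ.<⇒≤ ∘ π-mono) ℕ.<⇒≤
  (λ κ → ≡.sym (multiplicity-permute id π κ))

opposite-< : ∀ {n} {i j : Fin n} → i Fin.< j → opposite j Fin.< opposite i
opposite-< {n} {i} {j} i<j = subst₂ ℕ._<_ (≡.sym (Fin.opposite-prop j)) (≡.sym (Fin.opposite-prop i))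
  (ℕ.∸-monoʳ-< (s≤s i<j) (Fin.toℕ<n j))

combine-monoʳ-< : ∀ {m n} (κ : Fin m) {i j : Fin n} → i Fin.< j → combine κ i Fin.< combine κ j
combine-monoʳ-< {n = n} κ {i} {j} i<j =
  subst₂ ℕ._<_ (≡.sym (Fin.toℕ-combine κ i)) (≡.sym (Fin.toℕ-combine κ j)) (ℕ.+-monoʳ-< (n ℕ.* toℕ κ) i<j)

-- σ sends the class of positions labelled κ to the class labelled τ κ, in
-- increasing order for positive κ and in decreasing order for negative κ.
record Compatible {n M} (τ : Fin M → Fin M) (sgn : Fin M → Sign)
    (L : Fin n → Fin M) (σ : Fin n → Fin n) : Set where
  field
    monotone   : Monotone L
    involutive : ∀ i → σ (σ i) ≡ i
    swaps      : ∀ i → L (σ i) ≡ τ (L i)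
    increasing : ∀ {i j} → i Fin.< j → L i ≡ L j → sgn (L i) ≡ Sign.+ → σ i Fin.< σ j
    decreasing : ∀ {i j} → i Fin.< j → L i ≡ L j → sgn (L i) ≡ Sign.- → σ j Fin.< σ i

  permutation : Permutation n n
  permutation = Perm.permutation σ σ involutive involutive

compatible-cong : ∀ {n M τ sgn} {L L′ : Fin n → Fin M} {σ} → (∀ i → L i ≡ L′ i) →
  Compatible τ sgn L σ → Compatible τ sgn L′ σ
compatible-cong {τ = τ} {sgn} {L} {L′} {σ} L≗L′ C = record
  { monotone   = λ {i} {j} i<j → subst₂ Fin._≤_ (L≗L′ i) (L≗L′ j) (C.monotone i<j)
  ; involutive = C.involutive
  ; swaps      = λ i → ≡.trans (≡.sym (L≗L′ (σ i))) (≡.trans (C.swaps i) (cong τ (L≗L′ i)))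
  ; increasing = λ {i} {j} i<j eq s → C.increasing i<j
      (≡.trans (L≗L′ i) (≡.trans eq (≡.sym (L≗L′ j)))) (≡.trans (cong sgn (L≗L′ i)) s)
  ; decreasing = λ {i} {j} i<j eq s → C.decreasing i<j
      (≡.trans (L≗L′ i) (≡.trans eq (≡.sym (L≗L′ j)))) (≡.trans (cong sgn (L≗L′ i)) s)
  }
  where module C = Compatible C

module _ {M} (τ : Fin M → Fin M) (ττ : ∀ κ → τ (τ κ) ≡ κ)
         (sgn : Fin M → Sign) (sgn-τ : ∀ κ → sgn (τ κ) ≡ sgn κ) where

  -- The composite σ σ′ preserves every class, and on a class it composes two increasing or two
  -- decreasing maps. Since the classes are intervals in label order, it increases throughout and is
  -- the identity; evaluation at σ′ i gives the claim because σ′ is an involution.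
  compatible-unique : ∀ {n} {L : Fin n → Fin M} {σ σ′} →
    Compatible τ sgn L σ → Compatible τ sgn L σ′ → ∀ i → σ i ≡ σ′ i
  compatible-unique {n} {L} {σ} {σ′} C C′ i =
    ≡.trans (cong σ (≡.sym (C′.involutive i))) (increasing-permutation
      (C′.permutation Perm.∘ₚ C.permutation) (λ {i} {j} i<j → step i<j) (σ′ i))
    where
    module C = Compatible C
    module C′ = Compatible C′
    step : ∀ {i j} → i Fin.< j → σ (σ′ i) Fin.< σ (σ′ j)
    step {i} {j} i<j with Fin.<-cmp (L i) (L j)
    ... | tri> _ _ Lj<Li = contradiction (C.monotone i<j) (ℕ.<⇒≱ Lj<Li)
    ... | tri< Li<Lj _ _ = ℕ.≰⇒> λ σj≤σi → contradiction
      (subst₂ Fin._≤_ (Lσσ′ j) (Lσσ′ i) (monotone-≤ σj≤σi)) (ℕ.<⇒≱ Li<Lj)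
      where
      Lσσ′ : ∀ i → L (σ (σ′ i)) ≡ L i
      Lσσ′ i = ≡.trans (C.swaps (σ′ i)) (≡.trans (cong τ (C′.swaps i)) (ττ (L i)))
      monotone-≤ : ∀ {i j} → i Fin.≤ j → L i Fin.≤ L j
      monotone-≤ {i} {j} i≤j with i Fin.≟ j
      ... | yes refl = ℕ.≤-refl
      ... | no  i≢j  = C.monotone (Fin.≤∧≢⇒< i≤j i≢j)
    ... | tri≈ _ Li≡Lj _ = by-sign (sgn (L i)) refl
      where
      Lσ′≡ : L (σ′ i) ≡ L (σ′ j)
      Lσ′≡ = ≡.trans (C′.swaps i) (≡.trans (cong τ Li≡Lj) (≡.sym (C′.swaps j)))
      sgnσ′ : sgn (L (σ′ i)) ≡ sgn (L i)
      sgnσ′ = ≡.trans (cong sgn (C′.swaps i)) (sgn-τ (L i))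
      by-sign : ∀ s → sgn (L i) ≡ s → σ (σ′ i) Fin.< σ (σ′ j)
      by-sign Sign.+ eq = C.increasing (C′.increasing i<j Li≡Lj eq) Lσ′≡ (≡.trans sgnσ′ eq)
      by-sign Sign.- eq = C.decreasing (C′.decreasing i<j Li≡Lj eq) (≡.sym Lσ′≡)
        (≡.trans (cong sgn (≡.sym Lσ′≡)) (≡.trans sgnσ′ eq))

  -- Reindexing by σ matches the class of κ with that of τ κ.
  multiplicity-τ : ∀ {n} {L : Fin n → Fin M} {σ} → Compatible τ sgn L σ →
    ∀ κ → multiplicity L (τ κ) ≡ multiplicity L κ
  multiplicity-τ {L = L} {σ} C κ = ≡.trans (multiplicity-permute L C.permutation (τ κ))
    (sum-cong-≗ λ i → ι-cong (L (σ i) Fin.≟ τ κ) (L i Fin.≟ κ)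
      (λ eq → ≡.trans (≡.sym (ττ (L i))) (≡.trans (cong τ (≡.trans (≡.sym (C.swaps i)) eq)) (ττ κ)))
      (λ eq → ≡.trans (C.swaps i) (cong τ eq)))
    where module C = Compatible C

  -- Ranking the positions by τ (L i) moves each class into the place of its partner class, which
  -- has the same length by symmetry. Ties are broken forwards or backwards according to the sign.
  compatible-exists : ∀ {n} {L : Fin n → Fin M} → Monotone L →
    (∀ κ → multiplicity L (τ κ) ≡ multiplicity L κ) → ∃ λ σ → Compatible τ sgn L σ
  compatible-exists {n} {L} L-mono L-sym = σ , record
    { monotone   = L-mono
    ; involutive = λ i → increasing-permutation (π Perm.∘ₚ π) σσ-mono i
    ; swaps      = Lσ≡
    ; increasing = λ i<j eq s → π-mono (key-increasing i<j eq s)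
    ; decreasing = λ i<j eq s → π-mono (key-decreasing i<j eq s)
    }
    where
    twist : Sign → Fin n → Fin n
    twist Sign.+ i = i
    twist Sign.- i = opposite i

    twist-injective : ∀ s {i j} → twist s i ≡ twist s j → i ≡ j
    twist-injective Sign.+ eq = eq
    twist-injective Sign.- eq = ≡.trans (≡.sym (Fin.opposite-involutive _))
      (≡.trans (cong opposite eq) (Fin.opposite-involutive _))

    τ-injective : ∀ {κ μ} → τ κ ≡ τ μ → κ ≡ μ
    τ-injective {κ} {μ} eq = ≡.trans (≡.sym (ττ κ)) (≡.trans (cong τ eq) (ττ μ))

    -- σ i is the rank of i in the order that compares τ (L i) first.
    key : Fin n → Fin (M ℕ.* n)
    key i = combine (τ (L i)) (twist (sgn (L i)) i)

    key-injective : Injective _≡_ _≡_ key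
    key-injective {i} {j} eq
      with τ≡ , twist≡ ← Fin.combine-injective (τ (L i)) _ (τ (L j)) _ eq
      = twist-injective (sgn (L i))
          (≡.trans twist≡ (cong (λ κ → twist (sgn κ) j) (≡.sym (τ-injective τ≡))))

    key-twist : ∀ {i j} → L i ≡ L j → twist (sgn (L i)) i Fin.< twist (sgn (L i)) j → key i Fin.< key j
    key-twist {i} {j} eq t<t = subst (λ κ → key i Fin.< combine (τ κ) (twist (sgn κ) j)) eq
      (combine-monoʳ-< (τ (L i)) t<t)

    key-increasing : ∀ {i j} → i Fin.< j → L i ≡ L j → sgn (L i) ≡ Sign.+ → key i Fin.< key j
    key-increasing {i} {j} i<j eq s =
      key-twist eq (subst (λ s → twist s i Fin.< twist s j) (≡.sym s) i<j)

    key-decreasing : ∀ {i j} → i Fin.< j → L i ≡ L j → sgn (L i) ≡ Sign.- → key j Fin.< key i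
    key-decreasing {i} {j} i<j eq s = key-twist (≡.sym eq)
      (subst (λ s → twist s j Fin.< twist s i) (≡.trans (≡.sym s) (cong sgn eq)) (opposite-< i<j))

    π = proj₁ (rank key key-injective)
    π-mono : ∀ {i j} → key i Fin.< key j → (π ⟨$⟩ʳ i) Fin.< (π ⟨$⟩ʳ j)
    π-mono = proj₂ (rank key key-injective)
    σ : Fin n → Fin n
    σ i = π ⟨$⟩ʳ i
    ρ : Fin n → Fin n
    ρ i = π ⟨$⟩ˡ i

    -- Listed in the order of ranks, τ ∘ L is sorted and has the multiplicities of L, so it
    -- coincides with L. This gives L (σ i) = τ (L i).
    τLρ-mono : Monotone (τ ∘ L ∘ ρ)
    τLρ-mono {i} {j} i<j = ℕ.≮⇒≥ λ τ<τ → ℕ.<-asym i<j (subst₂ Fin._<_ (Perm.inverseʳ π) (Perm.inverseʳ π)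
      (π-mono (Fin.combine-monoˡ-< (twist (sgn (L (ρ j))) (ρ j)) (twist (sgn (L (ρ i))) (ρ i)) τ<τ)))

    τLρ-multiplicity : ∀ κ → multiplicity L κ ≡ multiplicity (τ ∘ L ∘ ρ) κ
    τLρ-multiplicity κ = ≡.sym (≡.trans
      (≡.sym (multiplicity-permute (τ ∘ L) (Perm.flip π) κ))
      (≡.trans (sum-cong-≗ λ i → ι-cong (τ (L i) Fin.≟ κ) (L i Fin.≟ τ κ)
          (λ eq → ≡.trans (≡.sym (ττ (L i))) (cong τ eq))
          (λ eq → ≡.trans (cong τ eq) (ττ κ)))
        (L-sym κ)))

    Lσ≡ : ∀ i → L (σ i) ≡ τ (L i)
    Lσ≡ i = ≡.trans (sorted-unique L (τ ∘ L ∘ ρ) L-mono τLρ-mono τLρ-multiplicity (σ i))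
      (cong (τ ∘ L) (Perm.inverseˡ π))

    -- Applying σ twice returns each class to its place and cancels a reversal; an increasing
    -- permutation is the identity, so σ is an involution.
    σσ-mono : ∀ {i j} → i Fin.< j → σ (σ i) Fin.< σ (σ j)
    σσ-mono {i} {j} i<j with L i Fin.≟ L j
    ... | no  Li≢Lj = π-mono (Fin.combine-monoˡ-<
      (twist (sgn (L (σ i))) (σ i)) (twist (sgn (L (σ j))) (σ j))
      (subst₂ Fin._<_ (≡.sym (τLσ i)) (≡.sym (τLσ j)) (Fin.≤∧≢⇒< (L-mono i<j) Li≢Lj)))
      where
      τLσ : ∀ i → τ (L (σ i)) ≡ L i
      τLσ i = ≡.trans (cong τ (Lσ≡ i)) (ττ (L i))
    ... | yes Li≡Lj = by-sign (sgn (L i)) refl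
      where
      Lσi≡Lσj : L (σ i) ≡ L (σ j)
      Lσi≡Lσj = ≡.trans (Lσ≡ i) (≡.trans (cong τ Li≡Lj) (≡.sym (Lσ≡ j)))
      sgnσ : sgn (L (σ i)) ≡ sgn (L i)
      sgnσ = ≡.trans (cong sgn (Lσ≡ i)) (sgn-τ (L i))
      by-sign : ∀ s → sgn (L i) ≡ s → σ (σ i) Fin.< σ (σ j)
      by-sign Sign.+ s = π-mono (key-increasing (π-mono (key-increasing i<j Li≡Lj s)) Lσi≡Lσj (≡.trans sgnσ s))
      by-sign Sign.- s = π-mono (key-decreasing (π-mono (key-decreasing i<j Li≡Lj s)) (≡.sym Lσi≡Lσj)
        (≡.trans (cong sgn (≡.sym Lσi≡Lσj)) (≡.trans sgnσ s)))

  module FixedPoints {n} {L : Fin n → Fin M} {σ} (C : Compatible τ sgn L σ) where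
    open Compatible C

    fixed : Fin M → ℕ
    fixed κ = ∑ (λ i → ι (L i Fin.≟ κ) ℕ.* ι (σ i Fin.≟ i))

    ∑-fixed : ∑ fixed ≡ ∑ (λ i → ι (σ i Fin.≟ i))
    ∑-fixed = ∑-multiplicity L (λ i → ι (σ i Fin.≟ i))

    fixed-edge : ∀ κ → τ κ ≢ κ → fixed κ ≡ 0
    fixed-edge κ τκ≢κ = ∑-zero _ λ i → term i
      where
      term : ∀ i → ι (L i Fin.≟ κ) ℕ.* ι (σ i Fin.≟ i) ≡ 0
      term i with L i Fin.≟ κ | σ i Fin.≟ i
      ... | no  _    | _       = refl
      ... | yes _    | no _    = refl
      ... | yes refl | yes σi≡i = contradiction (≡.trans (≡.sym (swaps i)) (cong L σi≡i)) τκ≢κ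

    -- An increasing involution of a class is the identity: applying σ to σ i < i would give i < σ
    -- i.
    fixed-loop⁺ : ∀ κ → τ κ ≡ κ → sgn κ ≡ Sign.+ → fixed κ ≡ multiplicity L κ
    fixed-loop⁺ κ τκ≡κ s = sum-cong-≗ λ i → term i
      where
      fix : ∀ i → L i ≡ κ → σ i ≡ i
      fix i Li≡κ with Fin.<-cmp (σ i) i
      ... | tri≈ _ σi≡i _ = σi≡i
      ... | tri< σi<i _ _ = contradiction
        (subst (Fin._< σ i) (involutive i) (increasing σi<i eq (≡.trans (cong sgn (≡.trans eq Li≡κ)) s)))
        (ℕ.<-asym σi<i)
        where eq = ≡.trans (swaps i) (≡.trans (cong τ Li≡κ) (≡.trans τκ≡κ (≡.sym Li≡κ)))
      ... | tri> _ _ i<σi = contradiction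
        (subst (σ i Fin.<_) (involutive i) (increasing i<σi (≡.sym eq) (≡.trans (cong sgn Li≡κ) s)))
        (ℕ.<-asym i<σi)
        where eq = ≡.trans (swaps i) (≡.trans (cong τ Li≡κ) (≡.trans τκ≡κ (≡.sym Li≡κ)))
      term : ∀ i → ι (L i Fin.≟ κ) ℕ.* ι (σ i Fin.≟ i) ≡ ι (L i Fin.≟ κ)
      term i with L i Fin.≟ κ
      ... | no  _    = refl
      ... | yes Li≡κ = ≡.trans (ℕ.+-identityʳ _) (ι-true (σ i Fin.≟ i) (fix i Li≡κ))

    -- The non-fixed positions labelled κ pair off under σ, and a decreasing map
    -- has at most one fixed point.
    fixed-loop⁻ : ∀ κ → τ κ ≡ κ → sgn κ ≡ Sign.- → fixed κ ≡ parity (multiplicity L κ)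
    fixed-loop⁻ κ τκ≡κ s = ≡.sym (begin
      parity (multiplicity L κ)       ≡⟨ cong parity split ⟩
      parity (up ℕ.+ (up ℕ.+ fixed κ))    ≡⟨ parity-double up (fixed κ) ⟩
      parity (fixed κ)                ≡⟨ parity-≤1 (fixed κ) fixed≤1 ⟩
      fixed κ                         ∎)
      where
      open ≡.≡-Reasoning
      Lσ : ∀ i → ι (L (σ i) Fin.≟ κ) ≡ ι (L i Fin.≟ κ)
      Lσ i = ι-cong (L (σ i) Fin.≟ κ) (L i Fin.≟ κ)
        (λ eq → ≡.trans (≡.sym (ττ (L i))) (≡.trans (cong τ (≡.trans (≡.sym (swaps i)) eq)) τκ≡κ))
        (λ eq → ≡.trans (swaps i) (≡.trans (cong τ eq) τκ≡κ))
      up down : ℕ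
      up   = ∑ (λ i → ι (L i Fin.≟ κ) ℕ.* ι (i Fin.<? σ i))
      down = ∑ (λ i → ι (L i Fin.≟ κ) ℕ.* ι (σ i Fin.<? i))
      -- Reindexing by σ exchanges the positions below their image with those above it.
      down≡up : down ≡ up
      down≡up = ≡.trans (sum-permute (λ i → ι (L i Fin.≟ κ) ℕ.* ι (σ i Fin.<? i)) permutation)
        (sum-cong-≗ λ i → cong₂ ℕ._*_ (Lσ i)
          (cong (λ j → ι (j Fin.<? σ i)) (involutive i)))
      trichotomy : ∀ i → 1 ≡ ι (i Fin.<? σ i) ℕ.+ (ι (σ i Fin.<? i) ℕ.+ ι (σ i Fin.≟ i))
      trichotomy i with Fin.<-cmp i (σ i)
      ... | tri< a b d = ≡.sym (cong₂ ℕ._+_ (ι-true (i Fin.<? σ i) a)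
        (cong₂ ℕ._+_ (ι-false (σ i Fin.<? i) d) (ι-false (σ i Fin.≟ i) (b ∘ ≡.sym))))
      ... | tri≈ a b d = ≡.sym (cong₂ ℕ._+_ (ι-false (i Fin.<? σ i) a)
        (cong₂ ℕ._+_ (ι-false (σ i Fin.<? i) d) (ι-true (σ i Fin.≟ i) (≡.sym b))))
      ... | tri> a b d = ≡.sym (cong₂ ℕ._+_ (ι-false (i Fin.<? σ i) a)
        (cong₂ ℕ._+_ (ι-true (σ i Fin.<? i) d) (ι-false (σ i Fin.≟ i) (b ∘ ≡.sym))))
      split : multiplicity L κ ≡ up ℕ.+ (up ℕ.+ fixed κ)
      split = begin
        multiplicity L κ
          ≡⟨ sum-cong-≗ (λ i → ≡.trans (≡.sym (ℕ.*-identityʳ (ι (L i Fin.≟ κ))))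
               (≡.trans (cong (ι (L i Fin.≟ κ) ℕ.*_) (trichotomy i))
                 (≡.trans (ℕ.*-distribˡ-+ (ι (L i Fin.≟ κ)) _ _)
                   (cong (ι (L i Fin.≟ κ) ℕ.* ι (i Fin.<? σ i) ℕ.+_)
                     (ℕ.*-distribˡ-+ (ι (L i Fin.≟ κ)) _ _))))) ⟩
        ∑ (λ i → ι (L i Fin.≟ κ) ℕ.* ι (i Fin.<? σ i) ℕ.+
          (ι (L i Fin.≟ κ) ℕ.* ι (σ i Fin.<? i) ℕ.+ ι (L i Fin.≟ κ) ℕ.* ι (σ i Fin.≟ i)))
          ≡⟨ ∑-distrib-+ (λ i → ι (L i Fin.≟ κ) ℕ.* ι (i Fin.<? σ i)) _ ⟩
        up ℕ.+ ∑ (λ i → ι (L i Fin.≟ κ) ℕ.* ι (σ i Fin.<? i) ℕ.+ ι (L i Fin.≟ κ) ℕ.* ι (σ i Fin.≟ i))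
          ≡⟨ cong (up ℕ.+_) (∑-distrib-+ (λ i → ι (L i Fin.≟ κ) ℕ.* ι (σ i Fin.<? i)) _) ⟩
        up ℕ.+ (down ℕ.+ fixed κ)
          ≡⟨ cong (λ d → up ℕ.+ (d ℕ.+ fixed κ)) down≡up ⟩
        up ℕ.+ (up ℕ.+ fixed κ) ∎
      parity-double : ∀ u k → parity (u ℕ.+ (u ℕ.+ k)) ≡ parity k
      parity-double zero    k = refl
      parity-double (suc u) k = ≡.trans (cong (parity ∘ suc) (ℕ.+-suc u (u ℕ.+ k))) (parity-double u k)
      parity-≤1 : ∀ k → k ℕ.≤ 1 → parity k ≡ k
      parity-≤1 zero          _ = refl
      parity-≤1 (suc zero)    _ = refl
      parity-≤1 (suc (suc k)) (s≤s ())
      FixedAt : Fin n → Set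
      FixedAt i = L i ≡ κ × σ i ≡ i
      fixed-unique : ∀ {i j} → FixedAt i → FixedAt j → i ≡ j
      fixed-unique {i} {j} (Li , σi) (Lj , σj) with Fin.<-cmp i j
      ... | tri≈ _ i≡j _ = i≡j
      ... | tri< i<j _ _ = contradiction
        (subst₂ Fin._<_ σj σi (decreasing i<j (≡.trans Li (≡.sym Lj)) (≡.trans (cong sgn Li) s)))
        (ℕ.<-asym i<j)
      ... | tri> _ _ j<i = contradiction
        (subst₂ Fin._<_ σi σj (decreasing j<i (≡.trans Lj (≡.sym Li)) (≡.trans (cong sgn Lj) s)))
        (ℕ.<-asym j<i)
      fixed≤1 : fixed κ ℕ.≤ 1
      fixed≤1 with Fin.any? (λ i → ι (L i Fin.≟ κ) ℕ.* ι (σ i Fin.≟ i) ℕ.≟ 1)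
      ... | no ∄i = ℕ.≤-trans (ℕ.≤-reflexive (∑-zero _ term)) z≤n
        where
        term : ∀ i → ι (L i Fin.≟ κ) ℕ.* ι (σ i Fin.≟ i) ≡ 0
        term i with L i Fin.≟ κ | σ i Fin.≟ i | ∄i ∘ (i ,_)
        ... | no  _ | _     | _   = refl
        ... | yes _ | no _  | _   = refl
        ... | yes _ | yes _ | ≢1 = contradiction refl ≢1
      ... | yes (i₀ , eq) = subst (fixed κ ℕ.≤_)
        (≡.trans (sum-cong-≗ (λ i → ≡.sym (ℕ.*-identityʳ (ι (i₀ Fin.≟ i))))) (∑-ι* i₀ 1))
        (∑-mono-≤ bound)
        where
        at : ∀ i → ι (L i Fin.≟ κ) ℕ.* ι (σ i Fin.≟ i) ≡ 1 → FixedAt i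
        at i eq with L i Fin.≟ κ | σ i Fin.≟ i
        at i () | no _ | _
        at i () | yes _ | no _
        ... | yes a | yes b = a , b
        bound : ∀ i → ι (L i Fin.≟ κ) ℕ.* ι (σ i Fin.≟ i) ℕ.≤ ι (i₀ Fin.≟ i)
        bound i with L i Fin.≟ κ | σ i Fin.≟ i
        ... | no  _ | _     = z≤n
        ... | yes _ | no _  = z≤n
        ... | yes a | yes b = ℕ.≤-reflexive (≡.sym (ι-true (i₀ Fin.≟ i) (fixed-unique (at i₀ eq) (a , b))))

-- Symmetric functions on labels and their values on orbits

module Orbits {M} (τ : Fin M → Fin M) (ττ : ∀ κ → τ (τ κ) ≡ κ)
              (sgn : Fin M → Sign) (sgn-τ : ∀ κ → sgn (τ κ) ≡ sgn κ) where

  Orbit : Set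
  Orbit = Kind × Fin M

  _∋_ : Orbit → Fin M → Set
  (_ , κ) ∋ μ = κ ≡ μ ⊎ τ κ ≡ μ

  _∋?_ : ∀ r μ → Dec (r ∋ μ)
  (_ , κ) ∋? μ = (κ Fin.≟ μ) ⊎-dec (τ κ Fin.≟ μ)

  HasKind : Orbit → Set
  HasKind (loop⁺ , κ) = τ κ ≡ κ × sgn κ ≡ Sign.+
  HasKind (loop⁻ , κ) = τ κ ≡ κ × sgn κ ≡ Sign.-
  HasKind (edge  , κ) = τ κ ≢ κ

  Separated : Orbit → Orbit → Set
  Separated r (_ , μ) = ¬ r ∋ μ

  Symmetric : (Fin M → ℕ) → Set
  Symmetric H = ∀ κ → H (τ κ) ≡ H κ

  -- A loop has κ = τ κ and must count its label once, so only edges add a second term.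
  contribution : Orbit → ℕ → Fin M → ℕ
  contribution (loop⁺ , κ) k μ = ι (κ Fin.≟ μ) ℕ.* k
  contribution (loop⁻ , κ) k μ = ι (κ Fin.≟ μ) ℕ.* k
  contribution (edge  , κ) k μ = ι (κ Fin.≟ μ) ℕ.* k ℕ.+ ι (τ κ Fin.≟ μ) ℕ.* k

  -- Passes from one number per orbit to a function on labels. `restrict` is its inverse on
  -- symmetric functions supported on the orbits.
  expand : (rs : List Orbit) → Vec ℕ (length rs) → Fin M → ℕ
  expand []       []       μ = 0
  expand (r ∷ rs) (k ∷ ks) μ = contribution r k μ ℕ.+ expand rs ks μ

  restrict : (Fin M → ℕ) → (rs : List Orbit) → Vec ℕ (length rs)
  restrict H []             = []
  restrict H ((_ , κ) ∷ rs) = H κ ∷ restrict H rs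

  τ-adjoint : ∀ κ μ → ι (κ Fin.≟ τ μ) ≡ ι (τ κ Fin.≟ μ)
  τ-adjoint κ μ = ι-cong (κ Fin.≟ τ μ) (τ κ Fin.≟ μ)
    (λ eq → ≡.trans (cong τ eq) (ττ μ)) (λ eq → ≡.trans (≡.sym (ττ κ)) (cong τ eq))

  contribution-∌ : ∀ r k μ → ¬ r ∋ μ → contribution r k μ ≡ 0
  contribution-∌ (loop⁺ , κ) k μ r∌μ = cong (ℕ._* k) (ι-false (κ Fin.≟ μ) (r∌μ ∘ inj₁))
  contribution-∌ (loop⁻ , κ) k μ r∌μ = cong (ℕ._* k) (ι-false (κ Fin.≟ μ) (r∌μ ∘ inj₁))
  contribution-∌ (edge  , κ) k μ r∌μ = cong₂ (λ i j → i ℕ.* k ℕ.+ j ℕ.* k)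
    (ι-false (κ Fin.≟ μ) (r∌μ ∘ inj₁)) (ι-false (τ κ Fin.≟ μ) (r∌μ ∘ inj₂))

  contribution-self : ∀ r k → HasKind r → contribution r k (proj₂ r) ≡ k
  contribution-self (loop⁺ , κ) k _ =
    ≡.trans (cong (ℕ._* k) (ι-true (κ Fin.≟ κ) refl)) (ℕ.*-identityˡ k)
  contribution-self (loop⁻ , κ) k _ =
    ≡.trans (cong (ℕ._* k) (ι-true (κ Fin.≟ κ) refl)) (ℕ.*-identityˡ k)
  contribution-self (edge  , κ) k τκ≢κ = ≡.trans
    (cong₂ (λ i j → i ℕ.* k ℕ.+ j ℕ.* k) (ι-true (κ Fin.≟ κ) refl) (ι-false (τ κ Fin.≟ κ) τκ≢κ))
    (≡.trans (ℕ.+-identityʳ _) (ℕ.*-identityˡ k))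

  contribution-symmetric : ∀ r k → HasKind r → Symmetric (contribution r k)
  contribution-symmetric (loop⁺ , κ) k (τκ≡κ , _) μ =
    cong (ℕ._* k) (≡.trans (τ-adjoint κ μ) (cong (λ κ → ι (κ Fin.≟ μ)) τκ≡κ))
  contribution-symmetric (loop⁻ , κ) k (τκ≡κ , _) μ =
    cong (ℕ._* k) (≡.trans (τ-adjoint κ μ) (cong (λ κ → ι (κ Fin.≟ μ)) τκ≡κ))
  contribution-symmetric (edge  , κ) k _ μ = ≡.trans
    (cong₂ (λ i j → i ℕ.* k ℕ.+ j ℕ.* k) (τ-adjoint κ μ)
      (≡.trans (τ-adjoint (τ κ) μ) (cong (λ κ → ι (κ Fin.≟ μ)) (ττ κ))))
    (ℕ.+-comm (ι (τ κ Fin.≟ μ) ℕ.* k) _)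

  ∑-contribution : ∀ r k → ∑ (contribution r k) ≡ sizeOf (proj₁ r) k
  ∑-contribution (loop⁺ , κ) k = ∑-ι* κ k
  ∑-contribution (loop⁻ , κ) k = ∑-ι* κ k
  ∑-contribution (edge  , κ) k =
    ≡.trans (∑-distrib-+ (λ μ → ι (κ Fin.≟ μ) ℕ.* k) _) (cong₂ ℕ._+_ (∑-ι* κ k) (∑-ι* (τ κ) k))

  ∑-expand : ∀ rs ks → ∑ (expand rs ks) ≡ size rs ks
  ∑-expand []       []       = ∑-zero {M} _ (λ _ → refl)
  ∑-expand (r ∷ rs) (k ∷ ks) =
    ≡.trans (∑-distrib-+ (contribution r k) _) (cong₂ ℕ._+_ (∑-contribution r k) (∑-expand rs ks))

  expand-symmetric : ∀ rs ks → All HasKind rs → Symmetric (expand rs ks)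
  expand-symmetric []       []       []         μ = refl
  expand-symmetric (r ∷ rs) (k ∷ ks) (hk ∷ hks) μ =
    cong₂ ℕ._+_ (contribution-symmetric r k hk μ) (expand-symmetric rs ks hks μ)

  expand-∌ : ∀ rs ks μ → (∀ {r} → r ∈ rs → ¬ r ∋ μ) → expand rs ks μ ≡ 0
  expand-∌ []       []       μ ∌μ = refl
  expand-∌ (r ∷ rs) (k ∷ ks) μ ∌μ =
    cong₂ ℕ._+_ (contribution-∌ r k μ (∌μ (here refl))) (expand-∌ rs ks μ (∌μ ∘ there))

  covered? : ∀ rs μ → Dec (∃ λ r → r ∈ rs × r ∋ μ)
  covered? rs μ with Any.any? (_∋? μ) rs
  ... | yes any = yes (find any)
  ... | no ¬any = no λ (r , r∈ , r∋μ) → ¬any (lose r∈ r∋μ)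

  expand-support : ∀ rs ks μ → expand rs ks μ ≢ 0 → ∃ λ r → r ∈ rs × r ∋ μ
  expand-support rs ks μ ≢0 with covered? rs μ
  ... | yes c = c
  ... | no ¬c = contradiction (expand-∌ rs ks μ λ r∈ r∋μ → ¬c (_ , r∈ , r∋μ)) ≢0

  restrict-cong : ∀ {H H′} rs → (∀ {r} → r ∈ rs → H (proj₂ r) ≡ H′ (proj₂ r)) →
    restrict H rs ≡ restrict H′ rs
  restrict-cong []       eq = refl
  restrict-cong (r ∷ rs) eq = cong₂ _∷_ (eq (here refl)) (restrict-cong rs (eq ∘ there))

  restrict-injective : ∀ {H H′} rs → restrict H rs ≡ restrict H′ rs →
    ∀ {r} → r ∈ rs → H (proj₂ r) ≡ H′ (proj₂ r)
  restrict-injective (r ∷ rs) eq (here refl) = Vec.∷-injectiveˡ eq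
  restrict-injective (r ∷ rs) eq (there r∈)  = restrict-injective rs (Vec.∷-injectiveʳ eq) r∈

  symmetric-∋ : ∀ {H} → Symmetric H → ∀ {r μ} → r ∋ μ → H μ ≡ H (proj₂ r)
  symmetric-∋ H-sym (inj₁ refl) = refl
  symmetric-∋ H-sym (inj₂ refl) = H-sym _

  ∼-sym : ∀ {κ μ} → κ ≡ μ ⊎ τ κ ≡ μ → μ ≡ κ ⊎ τ μ ≡ κ
  ∼-sym (inj₁ refl) = inj₁ refl
  ∼-sym (inj₂ refl) = inj₂ (ττ _)

  -- At the representative of an orbit only that orbit contributes. `AllPairs` separates earlier
  -- orbits from later representatives; the converse holds because τ is an involution.
  restrict-expand : ∀ rs ks → All HasKind rs → AllPairs Separated rs →
    restrict (expand rs ks) rs ≡ ks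
  restrict-expand []       []       []         []         = refl
  restrict-expand (r ∷ rs) (k ∷ ks) (hk ∷ hks) (sep ∷ seps) = cong₂ _∷_
    (≡.trans (cong₂ ℕ._+_ (contribution-self r k hk)
        (expand-∌ rs ks (proj₂ r) (λ r′∈ r′∋r → All.lookup sep r′∈ (∼-sym r′∋r))))
      (ℕ.+-identityʳ k))
    (≡.trans (restrict-cong rs λ {r′} r′∈ →
        cong (ℕ._+ expand rs ks (proj₂ r′)) (contribution-∌ r k (proj₂ r′) (All.lookup sep r′∈)))
      (restrict-expand rs ks hks seps))

  -- On a covered label both sides equal their value at the representative, where `restrict-expand`
  -- compares them; elsewhere both vanish.
  expand-restrict : ∀ {H} rs → All HasKind rs → AllPairs Separated rs → Symmetric H →
    (∀ μ → H μ ≢ 0 → ∃ λ r → r ∈ rs × r ∋ μ) →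
    ∀ μ → expand rs (restrict H rs) μ ≡ H μ
  expand-restrict {H} rs hks seps H-sym H-supp μ with covered? rs μ
  ... | yes (r , r∈ , r∋μ) = ≡.trans (symmetric-∋ (expand-symmetric rs (restrict H rs) hks) {r} r∋μ)
    (≡.trans (restrict-injective rs (restrict-expand rs (restrict H rs) hks seps) r∈)
      (≡.sym (symmetric-∋ H-sym {r} r∋μ)))
  ... | no ¬c = ≡.trans (expand-∌ rs (restrict H rs) μ (λ r∈ r∋μ → ¬c (_ , r∈ , r∋μ))) (≡.sym Hμ≡0)
    where
    Hμ≡0 : H μ ≡ 0
    Hμ≡0 with H μ ℕ.≟ 0
    ... | yes eq = eq
    ... | no ≢0  = contradiction (H-supp μ ≢0) ¬c

  size-restrict : ∀ {H} rs → All HasKind rs → AllPairs Separated rs → Symmetric H →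
    (∀ μ → H μ ≢ 0 → ∃ λ r → r ∈ rs × r ∋ μ) → size rs (restrict H rs) ≡ ∑ H
  size-restrict {H} rs hks seps H-sym H-supp = ≡.trans (≡.sym (∑-expand rs (restrict H rs)))
    (sum-cong-≗ (expand-restrict rs hks seps H-sym H-supp))

  module _ {n} {L : Fin n → Fin M} {σ} (C : Compatible τ sgn L σ) (rs : List Orbit)
           (hks : All HasKind rs) (seps : AllPairs Separated rs)
           (cover : ∀ i → ∃ λ r → r ∈ rs × r ∋ L i) where
    open FixedPoints τ ττ sgn sgn-τ C

    multiplicity-support : ∀ μ → multiplicity L μ ≢ 0 → ∃ λ r → r ∈ rs × r ∋ μ
    multiplicity-support μ ≢0 with multiplicity≢0⇒∃ L μ ≢0
    ... | i , refl = cover i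

    size≡n : size rs (restrict (multiplicity L) rs) ≡ n
    size≡n = ≡.trans
      (size-restrict rs hks seps (multiplicity-τ τ ττ sgn sgn-τ C) multiplicity-support)
      (≡.trans (sum-cong-≗ λ κ → sum-cong-≗ λ i → ≡.sym (ℕ.*-identityʳ (ι (L i Fin.≟ κ))))
        (≡.trans (∑-multiplicity L (λ _ → 1)) (∑-one n)))

    fixed-support : ∀ μ → fixed μ ≢ 0 → multiplicity L μ ≢ 0
    fixed-support μ ≢0 m≡0 = ≢0 (ℕ.n≤0⇒n≡0 (subst (fixed μ ℕ.≤_) m≡0 (∑-mono-≤ bound)))
      where
      bound : ∀ i → ι (L i Fin.≟ μ) ℕ.* ι (σ i Fin.≟ i) ℕ.≤ ι (L i Fin.≟ μ)
      bound i = ℕ.≤-trans (ℕ.*-monoʳ-≤ (ι (L i Fin.≟ μ)) (ι≤1 (σ i Fin.≟ i)))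
        (ℕ.≤-reflexive (ℕ.*-identityʳ _))

    fixed-symmetric : Symmetric fixed
    fixed-symmetric κ with τ κ Fin.≟ κ
    ... | yes τκ≡κ = cong fixed τκ≡κ
    ... | no  τκ≢κ = ≡.trans
      (fixed-edge (τ κ) (λ eq → τκ≢κ (≡.trans (≡.sym eq) (ττ κ))))
      (≡.sym (fixed-edge κ τκ≢κ))

    -- The fixed positions per label form a symmetric function as well, so `size-restrict` can sum
    -- them just as it sums multiplicities. Doubling on edges is harmless because edges have none.
    fixes≡size : ∀ ss → All HasKind ss →
      fixes ss (restrict (multiplicity L) ss) ≡ size ss (restrict fixed ss)
    fixes≡size []                 []                = refl
    fixes≡size ((loop⁺ , κ) ∷ ss) ((t , s) ∷ hks) =
      cong₂ ℕ._+_ (≡.sym (fixed-loop⁺ κ t s)) (fixes≡size ss hks)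
    fixes≡size ((loop⁻ , κ) ∷ ss) ((t , s) ∷ hks) =
      cong₂ ℕ._+_ (≡.sym (fixed-loop⁻ κ t s)) (fixes≡size ss hks)
    fixes≡size ((edge  , κ) ∷ ss) (t ∷ hks) =
      cong₂ ℕ._+_ (≡.sym (cong₂ ℕ._+_ (fixed-edge κ t) (fixed-edge κ t))) (fixes≡size ss hks)

    fixes≡∑ : fixes rs (restrict (multiplicity L) rs) ≡ ∑ (λ i → ι (σ i Fin.≟ i))
    fixes≡∑ = ≡.trans (fixes≡size rs hks) (≡.trans
      (size-restrict rs hks seps fixed-symmetric (λ μ → multiplicity-support μ ∘ fixed-support μ))
      ∑-fixed)

-- Signed involutions as labellings

strictly-monotone⇒monotone : ∀ {m n} (g : Fin m → Fin n) →
  (∀ {i j} → i Fin.< j → g i Fin.< g j) → ∀ {i j} → i Fin.≤ j → g i Fin.≤ g j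
strictly-monotone⇒monotone g g-mono {i} {j} i≤j with i Fin.≟ j
... | yes refl = ℕ.≤-refl
... | no  i≢j  = ℕ.<⇒≤ (g-mono (Fin.≤∧≢⇒< i≤j i≢j))

toℤ-⁺≮⁺ : ∀ {n} (k l : Fin n) → ¬ toℤ (Sign.+ , l) ℤ.< toℤ (Sign.+ , k) → k Fin.≤ l
toℤ-⁺≮⁺ k l ≮ = ℕ.≮⇒≥ λ l<k → ≮ (ℤ.+<+ (s≤s l<k))

toℤ-⁻≮⁻ : ∀ {n} (k l : Fin n) → ¬ toℤ (Sign.- , l) ℤ.< toℤ (Sign.- , k) → l Fin.≤ k
toℤ-⁻≮⁻ k l ≮ = ℕ.≮⇒≥ λ k<l → ≮ (ℤ.-<- k<l)

Sign-cancel : ∀ s t → (s Sign.* t) Sign.* t ≡ s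
Sign-cancel s t = ≡.trans (Sign.*-assoc s t t)
  (≡.trans (cong (s Sign.*_) (Sign.s*s≡+ t)) (Sign.*-identityʳ s))

-- A label (a , s , c) records the block a of a position, the sign s of its
-- letter and the block c of its image; labels with equal a are ordered by the
-- value of s c.
module Labels (b : ℕ) where

  Label : Set
  Label = Fin (b ℕ.* (b ℕ.+ b))

  -- The negative half comes first and is reversed, so the order of `Fin` is that of signed values,
  -- with negative and positive zero kept apart.
  half : Sign → Fin b → Fin (b ℕ.+ b)
  half Sign.- c = opposite c ↑ˡ b
  half Sign.+ c = b ↑ʳ c

  label : Fin b → Sign → Fin b → Label
  label a s c = combine a (half s c)

  unhalf : Fin b ⊎ Fin b → Sign × Fin b
  unhalf (inj₁ c) = Sign.- , opposite c
  unhalf (inj₂ c) = Sign.+ , c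

  unlabel : Label → Fin b × Sign × Fin b
  unlabel κ = proj₁ (remQuot (b ℕ.+ b) κ) , unhalf (splitAt b (proj₂ (remQuot {b} (b ℕ.+ b) κ)))

  unhalf-half : ∀ s c → unhalf (splitAt b (half s c)) ≡ (s , c)
  unhalf-half Sign.- c = ≡.trans (cong unhalf (Fin.splitAt-↑ˡ b (opposite c) b))
    (cong (Sign.- ,_) (Fin.opposite-involutive c))
  unhalf-half Sign.+ c = cong unhalf (Fin.splitAt-↑ʳ b b c)

  unlabel-label : ∀ a s c → unlabel (label a s c) ≡ (a , s , c)
  unlabel-label a s c = ≡.trans
    (cong (λ (a , h) → a , unhalf (splitAt b h)) (Fin.remQuot-combine a (half s c)))
    (cong (a ,_) (unhalf-half s c))

  half-unhalf : ∀ x → (λ (s , c) → half s c) (unhalf x) ≡ join b b x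
  half-unhalf (inj₁ c) = cong (_↑ˡ b) (Fin.opposite-involutive c)
  half-unhalf (inj₂ c) = refl

  block partner : Label → Fin b
  block   κ = proj₁ (unlabel κ)
  partner κ = proj₂ (proj₂ (unlabel κ))

  sgn : Label → Sign
  sgn κ = proj₁ (proj₂ (unlabel κ))

  τ : Label → Label
  τ κ = label (partner κ) (sgn κ) (block κ)

  label-unlabel : ∀ κ → label (block κ) (sgn κ) (partner κ) ≡ κ
  label-unlabel κ = ≡.trans
    (cong (combine (block κ)) (≡.trans (half-unhalf (splitAt b h)) (Fin.join-splitAt b b h)))
    (Fin.combine-remQuot {b} (b ℕ.+ b) κ)
    where h = proj₂ (remQuot {b} (b ℕ.+ b) κ)

  block-label : ∀ a s c → block (label a s c) ≡ a
  block-label a s c = cong proj₁ (unlabel-label a s c)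

  sgn-label : ∀ a s c → sgn (label a s c) ≡ s
  sgn-label a s c = cong (proj₁ ∘ proj₂) (unlabel-label a s c)

  partner-label : ∀ a s c → partner (label a s c) ≡ c
  partner-label a s c = cong (proj₂ ∘ proj₂) (unlabel-label a s c)

  label-cong : ∀ {a a′ s s′ c c′} → a ≡ a′ → s ≡ s′ → c ≡ c′ → label a s c ≡ label a′ s′ c′
  label-cong refl refl refl = refl

  τ-label : ∀ a s c → τ (label a s c) ≡ label c s a
  τ-label a s c = label-cong (partner-label a s c) (sgn-label a s c) (block-label a s c)

  block-τ : ∀ κ → block (τ κ) ≡ partner κ
  block-τ κ = block-label (partner κ) (sgn κ) (block κ)

  ττ : ∀ κ → τ (τ κ) ≡ κ
  ττ κ = ≡.trans (τ-label (partner κ) (sgn κ) (block κ)) (label-unlabel κ)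

  sgn-τ : ∀ κ → sgn (τ κ) ≡ sgn κ
  sgn-τ κ = sgn-label (partner κ) (sgn κ) (block κ)

  label-block-< : ∀ {a a′} s c s′ c′ → a Fin.< a′ → label a s c Fin.< label a′ s′ c′
  label-block-< s c s′ c′ = Fin.combine-monoˡ-< (half s c) (half s′ c′)

  label-sign-< : ∀ a c c′ → label a Sign.- c Fin.< label a Sign.+ c′
  label-sign-< a c c′ = combine-monoʳ-< a (ℕ.<-≤-trans
    (subst (ℕ._< b) (≡.sym (Fin.toℕ-↑ˡ (opposite c) b)) (Fin.toℕ<n (opposite c)))
    (subst (b ℕ.≤_) (≡.sym (Fin.toℕ-↑ʳ b c′)) (ℕ.m≤m+n b (toℕ c′))))

  label-⁺-< : ∀ a {c c′} → c Fin.< c′ → label a Sign.+ c Fin.< label a Sign.+ c′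
  label-⁺-< a {c} {c′} c<c′ = combine-monoʳ-< a
    (subst₂ ℕ._<_ (≡.sym (Fin.toℕ-↑ʳ b c)) (≡.sym (Fin.toℕ-↑ʳ b c′)) (ℕ.+-monoʳ-< b c<c′))

  label-⁻-< : ∀ a {c c′} → c′ Fin.< c → label a Sign.- c Fin.< label a Sign.- c′
  label-⁻-< a {c} {c′} c′<c = combine-monoʳ-< a
    (subst₂ ℕ._<_ (≡.sym (Fin.toℕ-↑ˡ (opposite c) b)) (≡.sym (Fin.toℕ-↑ˡ (opposite c′) b)) (opposite-< c′<c))

  label-⁻-≤ : ∀ a {c c′} → c′ Fin.≤ c → label a Sign.- c Fin.≤ label a Sign.- c′
  label-⁻-≤ a {c} {c′} c′≤c with c′ Fin.≟ c
  ... | yes refl = ℕ.≤-refl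
  ... | no  c′≢c = ℕ.<⇒≤ (label-⁻-< a (Fin.≤∧≢⇒< c′≤c c′≢c))

  block-mono : ∀ {κ μ} → κ Fin.≤ μ → block κ Fin.≤ block μ
  block-mono {κ} {μ} κ≤μ = ℕ.≮⇒≥ λ b<b → contradiction
    (subst₂ Fin._<_ (label-unlabel μ) (label-unlabel κ)
      (label-block-< (sgn μ) (partner μ) (sgn κ) (partner κ) b<b))
    (ℕ.≤⇒≯ κ≤μ)

  labels : ∀ {n} → Word n → Vec (Fin b) n → Fin n → Label
  labels π f i = label (lookup f i) (proj₁ (lookup π i)) (lookup f (∣ π ∣ʷ i))

  -- Absence of a descent allows no sign change from + to -, and for equal signs it orders k and l.
  -- The two implications, supplied by monotonicity of f, transfer that order to the blocks c and
  -- c′.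
  label-mono : ∀ {n} a s c s′ c′ (k l : Fin n) → ¬ toℤ (s′ , l) ℤ.< toℤ (s , k) →
    (k Fin.≤ l → c Fin.≤ c′) → (l Fin.≤ k → c′ Fin.≤ c) →
    label a s c Fin.≤ label a s′ c′
  label-mono a Sign.+ c Sign.+ c′ k l ≮ mono anti =
    strictly-monotone⇒monotone (label a Sign.+) (label-⁺-< a) (mono (toℤ-⁺≮⁺ k l ≮))
  label-mono a Sign.+ c Sign.- c′ k l ≮ mono anti = contradiction ℤ.-<+ ≮
  label-mono a Sign.- c Sign.+ c′ k l ≮ mono anti = ℕ.<⇒≤ (label-sign-< a c c′)
  label-mono a Sign.- c Sign.- c′ k l ≮ mono anti = label-⁻-≤ a (anti (toℤ-⁻≮⁻ k l ≮))

  involution-σ : ∀ {n} (π : Word n) → IsInvolution π → ∀ i → ∣ π ∣ʷ (∣ π ∣ʷ i) ≡ i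
  involution-σ π inv i = cong proj₂ (inv Sign.+ i)

  -- The sign picked up along i, |π_i|, i is the product of the two signs and must be +.
  involution-sign : ∀ {n} (π : Word n) → IsInvolution π → ∀ i →
    proj₁ (lookup π (∣ π ∣ʷ i)) ≡ proj₁ (lookup π i)
  involution-sign π inv i = ≡.trans (≡.sym (cong (Sign._* s′) (Sign.s*s≡+ s)))
    (≡.trans (Sign.*-assoc s s s′)
      (≡.trans (cong (s Sign.*_) (cong proj₁ (inv Sign.+ i))) (Sign.*-identityʳ s)))
    where
    s  = proj₁ (lookup π i)
    s′ = proj₁ (lookup π (∣ π ∣ʷ i))

module ChainLabels (m : ℕ) where
  open Labels (suc m)

  -- A negative letter is below the initial 0, which forces a positive block; the partner position
  -- is negative too.
  Valid : Label → Set
  Valid κ = sgn κ ≡ Sign.- → zero {m} Fin.< block κ × zero {m} Fin.< partner κ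

  module _ {n} (π : Word n) (inv : IsInvolution π) (f : Vec (Fin (suc m)) n)
           (chain : Chain zero 0ℤ (Vec.map toℤ π) f) where
    private
      s : Fin n → Sign
      s i = proj₁ (lookup π i)
      σ : Fin n → Fin n
      σ = ∣ π ∣ʷ

      lookup-toℤ : ∀ i → lookup (Vec.map toℤ π) i ≡ toℤ (lookup π i)
      lookup-toℤ i = Vec.lookup-map i toℤ π

      steps : ∀ {i j} → i Fin.< j → Step (lookup f i) (toℤ (lookup π i)) (lookup f j) (toℤ (lookup π j))
      steps {i} {j} i<j = subst₂ (λ u w → Step (lookup f i) u (lookup f j) w)
        (lookup-toℤ i) (lookup-toℤ j) (Chain⇒Steps (Vec.map toℤ π) f chain i<j)

      head-step : ∀ i → Step zero 0ℤ (lookup f i) (toℤ (lookup π i))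
      head-step i = subst (Step zero 0ℤ (lookup f i)) (lookup-toℤ i) (Chain⇒Step (Vec.map toℤ π) f chain i)

      f-mono : ∀ {i j} → i Fin.≤ j → lookup f i Fin.≤ lookup f j
      f-mono {i} {j} i≤j with i Fin.≟ j
      ... | yes refl = ℕ.≤-refl
      ... | no  i≢j  = proj₁ (steps (Fin.≤∧≢⇒< i≤j i≢j))

      ≮ : ∀ {i j} → i Fin.< j → lookup f i ≡ lookup f j → ¬ toℤ (lookup π j) ℤ.< toℤ (lookup π i)
      ≮ i<j eq lt = ℕ.<-irrefl (cong toℕ eq) (proj₂ (steps i<j) lt)

      σ-injective : ∀ {i j} → σ i ≡ σ j → i ≡ j
      σ-injective {i} {j} eq =
        ≡.trans (≡.sym (involution-σ π inv i)) (≡.trans (cong σ eq) (involution-σ π inv j))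

      block≡ : ∀ i → block (labels π f i) ≡ lookup f i
      block≡ i = block-label (lookup f i) (s i) (lookup f (σ i))

      sgn≡ : ∀ i → sgn (labels π f i) ≡ s i
      sgn≡ i = sgn-label (lookup f i) (s i) (lookup f (σ i))

      f≡ : ∀ {i j} → labels π f i ≡ labels π f j → lookup f i ≡ lookup f j
      f≡ {i} {j} eq = ≡.trans (≡.sym (block≡ i)) (≡.trans (cong block eq) (block≡ j))

      s≡ : ∀ {i j} → labels π f i ≡ labels π f j → s i ≡ s j
      s≡ {i} {j} eq = ≡.trans (≡.sym (sgn≡ i)) (≡.trans (cong sgn eq) (sgn≡ j))

    -- Equal labels mean equal block and sign, hence no descent. So |π| moves weakly in the
    -- direction given by the sign, and strictly because it is injective.
    compatible : Compatible τ sgn (labels π f) σ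
    compatible = record
      { monotone   = mono
      ; involutive = involution-σ π inv
      ; swaps      = λ i → ≡.trans
          (label-cong {a = lookup f (σ i)} refl (involution-sign π inv i) (cong (lookup f) (involution-σ π inv i)))
          (≡.sym (τ-label (lookup f i) (s i) (lookup f (σ i))))
      ; increasing = λ {i} {j} i<j eq p → Fin.≤∧≢⇒<
          (toℤ-⁺≮⁺ (σ i) (σ j) (subst₂ (λ t u → ¬ toℤ (t , σ j) ℤ.< toℤ (u , σ i))
            (≡.trans (≡.sym (s≡ eq)) (≡.trans (≡.sym (sgn≡ i)) p)) (≡.trans (≡.sym (sgn≡ i)) p) (≮ i<j (f≡ eq))))
          (λ σ≡ → ℕ.<-irrefl (cong toℕ (σ-injective σ≡)) i<j)
      ; decreasing = λ {i} {j} i<j eq p → Fin.≤∧≢⇒<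
          (toℤ-⁻≮⁻ (σ i) (σ j) (subst₂ (λ t u → ¬ toℤ (t , σ j) ℤ.< toℤ (u , σ i))
            (≡.trans (≡.sym (s≡ eq)) (≡.trans (≡.sym (sgn≡ i)) p)) (≡.trans (≡.sym (sgn≡ i)) p) (≮ i<j (f≡ eq))))
          (λ σ≡ → ℕ.<-irrefl (cong toℕ (σ-injective (≡.sym σ≡))) i<j)
      }
      where
      mono : Monotone (labels π f)
      mono {i} {j} i<j with lookup f i Fin.≟ lookup f j
      ... | no  fi≢fj = ℕ.<⇒≤ (label-block-< (s i) (lookup f (σ i)) (s j) (lookup f (σ j)) (Fin.≤∧≢⇒< (proj₁ (steps i<j)) fi≢fj))
      ... | yes fi≡fj = subst (λ a → labels π f i Fin.≤ label a (s j) (lookup f (σ j))) fi≡fj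
        (label-mono (lookup f i) (s i) _ (s j) _ (σ i) (σ j) (≮ i<j fi≡fj) (f-mono {σ i} {σ j}) (f-mono {σ j} {σ i}))

    valid : ∀ i → Valid (labels π f i)
    valid i sgn≡- = subst (zero {m} Fin.<_) (≡.sym (block≡ i)) (negative i s≡-) ,
      subst (zero {m} Fin.<_) (≡.sym (partner-label (lookup f i) (s i) (lookup f (σ i))))
        (negative (σ i) (≡.trans (involution-sign π inv i) s≡-))
      where
      s≡- : s i ≡ Sign.-
      s≡- = ≡.trans (≡.sym (sgn≡ i)) sgn≡-
      negative : ∀ j → s j ≡ Sign.- → zero {m} Fin.< lookup f j
      negative j sj≡- = proj₂ (head-step j)
        (subst (λ t → toℤ (t , σ j) ℤ.< 0ℤ) (≡.sym sj≡-) ℤ.-<+)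

  module _ {n} {L : Fin n → Label} {σ} (C : Compatible τ sgn L σ) (L-valid : ∀ i → Valid (L i)) where
    open Compatible C

    word : Word n
    word = tabulate (λ i → sgn (L i) , σ i)

    blocks : Vec (Fin (suc m)) n
    blocks = tabulate (block ∘ L)

    private
      lookup-word : ∀ i → lookup word i ≡ (sgn (L i) , σ i)
      lookup-word i = Vec.lookup∘tabulate _ i

      lookup-blocks : ∀ i → lookup blocks i ≡ block (L i)
      lookup-blocks i = Vec.lookup∘tabulate _ i

      ∣word∣ : ∀ i → ∣ word ∣ʷ i ≡ σ i
      ∣word∣ i = cong proj₂ (lookup-word i)

    word-involution : IsInvolution word
    word-involution s i = ≡.trans (cong (word ⟨_⟩) (act s i)) (≡.trans (act (s Sign.* sgn (L i)) (σ i)) (cong₂ _,_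
      (≡.trans (cong ((s Sign.* sgn (L i)) Sign.*_) (≡.trans (cong sgn (swaps i)) (sgn-τ (L i))))
        (Sign-cancel s (sgn (L i))))
      (involutive i)))
      where
      act : ∀ s i → word ⟨ s , i ⟩ ≡ (s Sign.* sgn (L i) , σ i)
      act s i = cong (λ (t , j) → s Sign.* t , j) (lookup-word i)

    word-signedPermutation : IsSignedPermutation word
    word-signedPermutation =
      (λ {i} {j} eq → ≡.trans (≡.sym (∣∣-involutive i)) (≡.trans (cong ∣ word ∣ʷ eq) (∣∣-involutive j))) ,
      strictlySurjective⇒surjective (λ j → ∣ word ∣ʷ j , ∣∣-involutive j)
      where
      ∣∣-involutive : ∀ i → ∣ word ∣ʷ (∣ word ∣ʷ i) ≡ i
      ∣∣-involutive = involution-σ word word-involution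

    labels-word : ∀ i → labels word blocks i ≡ L i
    labels-word i = ≡.trans
      (label-cong (lookup-blocks i) (cong proj₁ (lookup-word i))
        (≡.trans (cong (lookup blocks) (∣word∣ i)) (≡.trans (lookup-blocks (σ i))
          (≡.trans (cong block (swaps i)) (block-τ (L i))))))
      (label-unlabel (L i))

    word-chain : Chain zero 0ℤ (Vec.map toℤ word) blocks
    word-chain = Steps⇒Chain (Vec.map toℤ word) blocks
      (λ i → subst₂ (Step zero 0ℤ) (≡.sym (lookup-blocks i)) (≡.sym (lookup-toℤ i))
        (z≤n , λ lt → head i lt))
      (λ {i} {j} i<j → subst₂ (λ a u → Step a u (lookup blocks j) (lookup (Vec.map toℤ word) j))
        (≡.sym (lookup-blocks i)) (≡.sym (lookup-toℤ i))
        (subst₂ (Step (block (L i)) (toℤ (sgn (L i) , σ i))) (≡.sym (lookup-blocks j)) (≡.sym (lookup-toℤ j))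
          (block-mono (monotone i<j) , λ lt → Fin.≤∧≢⇒< (block-mono (monotone i<j)) (strict i<j lt))))
      where
      lookup-toℤ : ∀ i → lookup (Vec.map toℤ word) i ≡ toℤ (sgn (L i) , σ i)
      lookup-toℤ i = ≡.trans (Vec.lookup-map i toℤ word) (cong toℤ (lookup-word i))

      head : ∀ i → toℤ (sgn (L i) , σ i) ℤ.< 0ℤ → zero {m} Fin.< block (L i)
      head i lt with sgn (L i) | L-valid i
      head i (ℤ.+<+ ()) | Sign.+ | _
      head i lt         | Sign.- | v = proj₁ (v refl)

      partner-mono : ∀ {i j} → σ i Fin.< σ j → partner (L i) Fin.≤ partner (L j)
      partner-mono {i} {j} lt = subst₂ Fin._≤_ (block-σ i) (block-σ j) (block-mono (monotone lt))
        where
        block-σ : ∀ i → block (L (σ i)) ≡ partner (L i)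
        block-σ i = ≡.trans (cong block (swaps i)) (block-τ (L i))

      -- Suppose a descent inside one block. A sign change contradicts sortedness or the descent
      -- itself. For equal signs, sortedness and the descent bound the partners in opposite
      -- directions, so the labels agree and the prescribed direction of σ contradicts the descent.
      strict : ∀ {i j} → i Fin.< j → toℤ (sgn (L j) , σ j) ℤ.< toℤ (sgn (L i) , σ i) →
        block (L i) ≢ block (L j)
      strict {i} {j} i<j lt eq = by-sign (sgn (L i)) (sgn (L j)) refl refl lt
        where
        ordered : ∀ s t → sgn (L i) ≡ s → sgn (L j) ≡ t →
          label (block (L i)) s (partner (L i)) Fin.≤ label (block (L i)) t (partner (L j))
        ordered s t si sj = subst₂ Fin._≤_
          (≡.trans (≡.sym (label-unlabel (L i))) (label-cong {a = block (L i)} {c = partner (L i)} refl si refl))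
          (≡.trans (≡.sym (label-unlabel (L j))) (label-cong {c = partner (L j)} (≡.sym eq) sj refl))
          (monotone i<j)
        L≡ : ∀ s → sgn (L i) ≡ s → sgn (L j) ≡ s → partner (L i) ≡ partner (L j) → L i ≡ L j
        L≡ s si sj p = ≡.trans (≡.sym (label-unlabel (L i)))
          (≡.trans (label-cong eq (≡.trans si (≡.sym sj)) p) (label-unlabel (L j)))
        by-sign : ∀ s t → sgn (L i) ≡ s → sgn (L j) ≡ t → ¬ toℤ (t , σ j) ℤ.< toℤ (s , σ i)
        by-sign Sign.+ Sign.- si sj _ =
          ℕ.<⇒≱ (label-sign-< (block (L i)) (partner (L j)) (partner (L i))) (ordered _ _ si sj)
        by-sign Sign.- Sign.+ si sj ()
        by-sign Sign.+ Sign.+ si sj (ℤ.+<+ lt) = ℕ.<-asym (s<s⁻¹ lt)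
          (increasing i<j (L≡ Sign.+ si sj (Fin.≤-antisym
            (ℕ.≮⇒≥ λ c<c → ℕ.<⇒≱ (label-⁺-< (block (L i)) c<c) (ordered _ _ si sj))
            (partner-mono (s<s⁻¹ lt)))) si)
        by-sign Sign.- Sign.- si sj (ℤ.-<- lt) = ℕ.<-asym lt
          (decreasing i<j (L≡ Sign.- si sj (Fin.≤-antisym
            (partner-mono lt)
            (ℕ.≮⇒≥ λ c<c → ℕ.<⇒≱ (label-⁻-< (block (L i)) c<c) (ordered _ _ si sj)))) si)

-- Orbit representatives of the labels

triangle : ∀ n → List (Fin n × Fin n)
triangle zero    = []
triangle (suc n) = map (_, zero) (allFin (suc n)) ++ map (λ (a , b) → suc a , suc b) (triangle n)

∈-triangle⁺ : ∀ {n} {a b : Fin n} → b Fin.≤ a → (a , b) ∈ triangle n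
∈-triangle⁺ {suc n} {a}     {zero}  b≤a = ∈-++⁺ˡ (∈-map⁺ (_, zero) (∈-allFin a))
∈-triangle⁺ {suc n} {suc a} {suc b} b≤a = ∈-++⁺ʳ _ (∈-map⁺ _ (∈-triangle⁺ (s≤s⁻¹ b≤a)))

∈-triangle⁻ : ∀ {n} {a b : Fin n} → (a , b) ∈ triangle n → b Fin.≤ a
∈-triangle⁻ {suc n} ab∈ with ∈-++⁻ (map (_, zero) (allFin (suc n))) ab∈
... | inj₁ ab∈₁ with ∈-map⁻ (_, zero) ab∈₁
...   | _ , _ , refl = z≤n
∈-triangle⁻ {suc n} ab∈ | inj₂ ab∈₂ with ∈-map⁻ _ ab∈₂
...   | _ , ab∈′ , refl = s≤s (∈-triangle⁻ ab∈′)

triangle-unique : ∀ n → Unique (triangle n)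
triangle-unique zero    = []
triangle-unique (suc n) = Unique.++⁺
  (Unique.map⁺ ,-injectiveˡ (Unique.allFin⁺ (suc n)))
  (Unique.map⁺ (λ eq → cong₂ _,_ (Fin.suc-injective (,-injectiveˡ eq)) (Fin.suc-injective (,-injectiveʳ eq)))
    (triangle-unique n))
  λ (v∈₁ , v∈₂) → disjoint (∈-map⁻ (_, zero) v∈₁) (∈-map⁻ _ v∈₂)
  where
  disjoint : ∀ {v} → (∃ λ a → a ∈ allFin (suc n) × v ≡ (a , zero)) →
    (∃ λ ab → ab ∈ triangle n × v ≡ (suc (proj₁ ab) , suc (proj₂ ab))) → _
  disjoint (_ , _ , refl) (_ , _ , ())

loop : Sign → Kind
loop Sign.+ = loop⁺
loop Sign.- = loop⁻

kindOf : ∀ {n} → Sign → Fin n × Fin n → Kind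
kindOf s (a , b) = if does (a Fin.≟ b) then loop s else edge

tabulate-const : ∀ {A : Set} (x : A) n → List.tabulate {n = n} (λ _ → x) ≡ replicate n x
tabulate-const x zero    = refl
tabulate-const x (suc n) = cong (x ∷_) (tabulate-const x n)

-- The column b = 0 holds one diagonal pair and n others; raising both entries by one keeps the
-- kind.
kinds-triangle : ∀ s n → map (kindOf s) (triangle (suc n)) ≡
  loop s ∷ replicate n edge ++ map (kindOf s) (triangle n)
kinds-triangle s n = cong (loop s ∷_) (≡.trans
  (List.map-++ (kindOf s) (map (_, zero) (List.tabulate suc)) _)
  (cong₂ _++_
    (≡.trans (≡.sym (List.map-∘ (List.tabulate suc)))
      (≡.trans (List.map-tabulate suc (kindOf s ∘ (_, zero))) (tabulate-const edge n)))
    (≡.sym (List.map-∘ (triangle n)))))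

-- The binomial coefficient n choose 2, the number of pairs b < a below n.
edges : ℕ → ℕ
edges zero    = 0
edges (suc n) = n ℕ.+ edges n

-- The factors 1 - z² come from the positive edges, the negative loops and the negative edges, in
-- this order.
edges-total : ∀ m → edges (suc m) ℕ.+ (m ℕ.+ edges m) ≡ m ℕ.* suc m
edges-total zero    = refl
edges-total (suc m) = ≡.trans (double m (edges (suc m)))
  (≡.trans (cong (2 ℕ.* suc m ℕ.+_) (edges-total m)) (product m))
  where
  double : ∀ m e → (suc m ℕ.+ e) ℕ.+ (suc m ℕ.+ e) ≡ 2 ℕ.* suc m ℕ.+ (e ℕ.+ e)
  double = solve-∀
  product : ∀ m → 2 ℕ.* suc m ℕ.+ m ℕ.* suc m ≡ suc m ℕ.* suc (suc m)
  product = solve-∀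

module LabelOrbits (m : ℕ) where
  open Labels (suc m)
  open ChainLabels m using (Valid)
  open Orbits τ ττ sgn sgn-τ

  Shape : Set
  Shape = Fin (suc m) × Sign × Fin (suc m)

  -- The negative shapes use the triangle on m blocks, raised past block zero.
  shapes : List Shape
  shapes = map (λ (a , b) → a , Sign.+ , b) (triangle (suc m)) ++
           map (λ (a , b) → suc a , Sign.- , suc b) (triangle m)

  orbit : Shape → Orbit
  orbit (a , s , b) = kindOf s (a , b) , label a s b

  orbits : List Orbit
  orbits = map orbit shapes

  Admissible : Shape → Set
  Admissible (a , s , b) = s ≡ Sign.- → zero {m} Fin.< a × zero {m} Fin.< b

  ∈-shapes⁺ : ∀ a s b → b Fin.≤ a → Admissible (a , s , b) → (a , s , b) ∈ shapes
  ∈-shapes⁺ a       Sign.+ b       b≤a adm = ∈-++⁺ˡ (∈-map⁺ _ (∈-triangle⁺ b≤a))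
  ∈-shapes⁺ (suc a) Sign.- (suc b) b≤a adm =
    ∈-++⁺ʳ (map _ (triangle (suc m))) (∈-map⁺ _ (∈-triangle⁺ (s≤s⁻¹ b≤a)))
  ∈-shapes⁺ zero    Sign.- b       b≤a adm = contradiction (proj₁ (adm refl)) λ ()
  ∈-shapes⁺ (suc a) Sign.- zero    b≤a adm = contradiction (proj₂ (adm refl)) λ ()

  ∈-shapes⁻ : ∀ {a s b} → (a , s , b) ∈ shapes → b Fin.≤ a × Admissible (a , s , b)
  ∈-shapes⁻ x∈ with ∈-++⁻ (map _ (triangle (suc m))) x∈
  ... | inj₁ x∈₁ with ∈-map⁻ _ x∈₁
  ...   | _ , ab∈ , refl = ∈-triangle⁻ ab∈ , λ ()
  ∈-shapes⁻ x∈ | inj₂ x∈₂ with ∈-map⁻ _ x∈₂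
  ...   | _ , ab∈ , refl = s≤s (∈-triangle⁻ ab∈) , λ _ → z<s , z<s

  shapes-unique : Unique shapes
  shapes-unique = Unique.++⁺
    (Unique.map⁺ (λ { refl → refl }) (triangle-unique (suc m)))
    (Unique.map⁺ (λ { refl → refl }) (triangle-unique m))
    λ (v∈₁ , v∈₂) → disjoint (∈-map⁻ _ v∈₁) (∈-map⁻ _ v∈₂)
    where
    disjoint : ∀ {v} →
      (∃ λ ab → ab ∈ triangle (suc m) × v ≡ (proj₁ ab , Sign.+ , proj₂ ab)) →
      (∃ λ ab → ab ∈ triangle m × v ≡ (suc (proj₁ ab) , Sign.- , suc (proj₂ ab))) → _
    disjoint (_ , _ , refl) (_ , _ , ())

  label-injective : ∀ {a s b a′ s′ b′} → label a s b ≡ label a′ s′ b′ → (a , s , b) ≡ (a′ , s′ , b′)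
  label-injective {a} {s} {b} {a′} {s′} {b′} eq =
    ≡.trans (≡.sym (unlabel-label a s b)) (≡.trans (cong unlabel eq) (unlabel-label a′ s′ b′))

  orbit-hasKind : ∀ x → HasKind (orbit x)
  orbit-hasKind (a , s , b) with a Fin.≟ b
  orbit-hasKind (a , Sign.+ , a) | yes refl = τ-label a Sign.+ a , sgn-label a Sign.+ a
  orbit-hasKind (a , Sign.- , a) | yes refl = τ-label a Sign.- a , sgn-label a Sign.- a
  ... | no a≢b = λ eq → a≢b (≡.sym (cong proj₁ (label-injective
    {b} {s} {a} {a} {s} {b} (≡.trans (≡.sym (τ-label a s b)) eq))))

  orbits-haveKind : All HasKind orbits
  orbits-haveKind = All.map⁺ {f = orbit} (All.universal orbit-hasKind shapes)

  -- A pair and its exchange both satisfy b ≤ a only on the diagonal, where they coincide.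
  orbits-separated : AllPairs Separated orbits
  orbits-separated = AllPairs-map⁺ orbit separated shapes-unique
    where
    separated : ∀ {x y} → x ∈ shapes → y ∈ shapes → x ≢ y → Separated (orbit x) (orbit y)
    separated {a , s , b} {a′ , s′ , b′} x∈ y∈ x≢y (inj₁ eq) =
      x≢y (label-injective {a} {s} {b} {a′} {s′} {b′} eq)
    separated {a , s , b} {a′ , s′ , b′} x∈ y∈ x≢y (inj₂ eq)
      with label-injective {b} {s} {a} {a′} {s′} {b′} (≡.trans (≡.sym (τ-label a s b)) eq)
    ... | refl = x≢y (cong₂ (λ u v → u , s , v) a≡b (≡.sym a≡b))
      where
      a≡b : a ≡ b
      a≡b = Fin.≤-antisym (proj₁ (∈-shapes⁻ y∈)) (proj₁ (∈-shapes⁻ x∈))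

  cover : ∀ κ → Valid κ → ∃ λ r → r ∈ orbits × r ∋ κ
  cover κ v with ℕ.≤-total (Fin.toℕ (partner κ)) (Fin.toℕ (block κ))
  ... | inj₁ b≤a = _ , ∈-map⁺ orbit (∈-shapes⁺ (block κ) (sgn κ) (partner κ) b≤a v) ,
    inj₁ (label-unlabel κ)
  ... | inj₂ a≤b = _ , ∈-map⁺ orbit (∈-shapes⁺ (partner κ) (sgn κ) (block κ) a≤b
      (λ eq → proj₂ (v eq) , proj₁ (v eq))) ,
    inj₂ (ττ κ)

  covered⇒valid : ∀ {r κ} → r ∈ orbits → r ∋ κ → Valid κ
  covered⇒valid r∈ r∋κ with ∈-map⁻ orbit r∈
  ... | (a , s , b) , x∈ , refl = valid r∋κ
    where
    adm = proj₂ (∈-shapes⁻ x∈)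
    valid : ∀ {κ} → orbit (a , s , b) ∋ κ → Valid κ
    valid (inj₁ refl) eq =
      subst (zero {m} Fin.<_) (≡.sym (block-label a s b)) (proj₁ (adm s≡-)) ,
      subst (zero {m} Fin.<_) (≡.sym (partner-label a s b)) (proj₂ (adm s≡-))
      where s≡- = ≡.trans (≡.sym (sgn-label a s b)) eq
    valid (inj₂ refl) eq =
      subst (zero {m} Fin.<_) (≡.sym (≡.trans (cong block (τ-label a s b)) (block-label b s a))) (proj₂ (adm s≡-)) ,
      subst (zero {m} Fin.<_) (≡.sym (≡.trans (cong partner (τ-label a s b)) (partner-label b s a))) (proj₁ (adm s≡-))
      where s≡- = ≡.trans (≡.sym (sgn-label a s b)) (≡.trans (≡.sym (sgn-τ (label a s b))) eq)

  orbit-kinds : map proj₁ orbits ≡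
    map (kindOf Sign.+) (triangle (suc m)) ++ map (kindOf Sign.-) (triangle m)
  orbit-kinds = ≡.trans (≡.sym (List.map-∘ shapes)) (≡.trans
    (List.map-++ (proj₁ ∘ orbit) (map _ (triangle (suc m))) _)
    (cong₂ _++_ (≡.sym (List.map-∘ (triangle (suc m)))) (≡.sym (List.map-∘ (triangle m)))))

-- The product formula for the orbits

module Quotient (S : RawRing c ℓ) (x : RawRing.Carrier S) where
  open PowerSeries S

  quotient : ℕ → Carrier
  quotient m =
    (1# + const x * X) ^ m / ((1# - const x * X) ^ suc m * (1# - X ^ 2) ^ (m ℕ.* suc m))

module OrbitSeries (R : CommutativeRing c ℓ) (x : CommutativeRing.Carrier R) where
  private
    module R = CommutativeRing R
  open SeriesRing R using (commutativeRing; X*-zero; /-unique; ^-unital; *-unital)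
  open CommutativeRing commutativeRing hiding (zero; _-_; refl)
  open PowerSeries R.rawRing using (X; const; _^_; _/_; _-_)
  open MultiplicitySeries R x
  open CommutativeSemigroup *-commutativeSemigroup using (x∙yz≈y∙xz)
  open SetoidReasoning setoid

  ∏-triangle : ∀ F s n → ∏ F (map (kindOf s) (triangle n)) ≈ F (loop s) ^ n * F edge ^ edges n
  ∏-triangle F s zero    = sym (*-identityˡ 1#)
  ∏-triangle F s (suc n) = begin
    ∏ F (map (kindOf s) (triangle (suc n)))
      ≈⟨ reflexive (cong (∏ F) (kinds-triangle s n)) ⟩
    l * ∏ F (replicate n edge ++ map (kindOf s) (triangle n))
      ≈⟨ *-congˡ {l} (∏-++ F (replicate n edge) _) ⟩
    l * (∏ F (replicate n edge) * ∏ F (map (kindOf s) (triangle n)))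
      ≈⟨ *-congˡ {l} (*-cong (∏-replicate F edge n) (∏-triangle F s n)) ⟩
    l * (e ^ n * (l ^ n * e ^ edges n))
      ≈⟨ *-congˡ {l} (x∙yz≈y∙xz (e ^ n) (l ^ n) (e ^ edges n)) ⟩
    l * (l ^ n * (e ^ n * e ^ edges n))
      ≈⟨ *-assoc l (l ^ n) _ ⟨
    l ^ suc n * (e ^ n * e ^ edges n)
      ≈⟨ *-congˡ {l ^ suc n} (^-+ e n (edges n)) ⟨
    l ^ suc n * e ^ edges (suc n) ∎
    where
    l = F (loop s)
    e = F edge

  ∏-orbits : ∀ F m → ∏ F (map proj₁ (LabelOrbits.orbits m)) ≈
    (F loop⁺ ^ suc m * F edge ^ edges (suc m)) * (F loop⁻ ^ m * F edge ^ edges m)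
  ∏-orbits F m = begin
    ∏ F (map proj₁ (LabelOrbits.orbits m))
      ≈⟨ reflexive (cong (∏ F) (LabelOrbits.orbit-kinds m)) ⟩
    ∏ F (map (kindOf Sign.+) (triangle (suc m)) ++ map (kindOf Sign.-) (triangle m))
      ≈⟨ ∏-++ F (map (kindOf Sign.+) (triangle (suc m))) _ ⟩
    ∏ F (map (kindOf Sign.+) (triangle (suc m))) * ∏ F (map (kindOf Sign.-) (triangle m))
      ≈⟨ *-cong (∏-triangle F Sign.+ (suc m)) (∏-triangle F Sign.- m) ⟩
    (F loop⁺ ^ suc m * F edge ^ edges (suc m)) * (F loop⁻ ^ m * F edge ^ edges m) ∎

  open Quotient R.rawRing x

  orbitSeries : ∀ m → quotient m ≈ series (LabelOrbits.orbits m)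
  orbitSeries m = /-unique ((1# + const x * X) ^ m) D F
    (*-unital (d₁ ^ suc m) (d₂ ^ (m ℕ.* suc m))
      (^-unital d₁ (suc m) (unital-d₁)) (^-unital d₂ (m ℕ.* suc m) unital-d₂)) (begin
    F * D                                              ≈⟨ *-comm F D ⟩
    D * F                                              ≈⟨ *-congʳ {F} denominators ⟨
    ∏ denominator (map proj₁ (LabelOrbits.orbits m)) * F
                                                       ≈⟨ series*∏ (LabelOrbits.orbits m) ⟩
    ∏ numerator (map proj₁ (LabelOrbits.orbits m))     ≈⟨ ∏-orbits numerator m ⟩
    (1# ^ suc m * 1# ^ edges (suc m)) * (r ^ m * 1# ^ edges m)
      ≈⟨ *-cong (*-cong (1^ (suc m)) (1^ (edges (suc m)))) (*-congˡ {r ^ m} (1^ (edges m))) ⟩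
    (1# * 1#) * (r ^ m * 1#)                           ≈⟨ *-cong (*-identityˡ 1#) (*-identityʳ (r ^ m)) ⟩
    1# * r ^ m                                         ≈⟨ *-identityˡ (r ^ m) ⟩
    r ^ m                                              ∎)
    where
    F = series (LabelOrbits.orbits m)
    d₁ = 1# - const x * X
    d₂ = 1# - X ^ 2
    r = 1# + const x * X
    D = d₁ ^ suc m * d₂ ^ (m ℕ.* suc m)
    unital : ∀ {a} → a R.≈ R.0# → R.1# R.- a R.≈ R.1#
    unital a≈0 = R.trans (R.+-congˡ (R.trans (R.-‿cong a≈0) (RingProperties.-0#≈0# R.ring)))
      (R.+-identityʳ R.1#)
    unital-d₁ : d₁ 0 R.≈ R.1#
    unital-d₁ = unital (R.trans (R.+-identityʳ _) (R.zeroʳ x))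
    unital-d₂ : d₂ 0 R.≈ R.1#
    unital-d₂ = unital (X*-zero (X ^ 1))
    denominators : ∏ denominator (map proj₁ (LabelOrbits.orbits m)) ≈ D
    denominators = begin
      ∏ denominator (map proj₁ (LabelOrbits.orbits m))
        ≈⟨ ∏-orbits denominator m ⟩
      (d₁ ^ suc m * d₂ ^ edges (suc m)) * (d₂ ^ m * d₂ ^ edges m)
        ≈⟨ *-assoc (d₁ ^ suc m) (d₂ ^ edges (suc m)) _ ⟩
      d₁ ^ suc m * (d₂ ^ edges (suc m) * (d₂ ^ m * d₂ ^ edges m))
        ≈⟨ *-congˡ {d₁ ^ suc m} (*-congˡ {d₂ ^ edges (suc m)} (^-+ d₂ m (edges m))) ⟨
      d₁ ^ suc m * (d₂ ^ edges (suc m) * d₂ ^ (m ℕ.+ edges m))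
        ≈⟨ *-congˡ {d₁ ^ suc m} (^-+ d₂ (edges (suc m)) (m ℕ.+ edges m)) ⟨
      d₁ ^ suc m * d₂ ^ (edges (suc m) ℕ.+ (m ℕ.+ edges m))
        ≈⟨ *-congˡ {d₁ ^ suc m} (reflexive (cong (d₂ ^_) (edges-total m))) ⟩
      D ∎

-- Comparison of coefficients

∈-vectors : ∀ {xs : List A} → (∀ x → x ∈ xs) → ∀ {k} (v : Vec A k) → v ∈ vectors xs k
∈-vectors all []      = here refl
∈-vectors all (x ∷ v) = ∈-cartesianProductWith⁺ _∷_ (all x) (∈-vectors all v)

vectors-unique : ∀ {xs : List A} → Unique xs → ∀ k → Unique (vectors xs k)
vectors-unique xs! zero    = [] ∷ []
vectors-unique xs! (suc k) =
  Unique.cartesianProductWith⁺ _∷_ Vec.∷-injective xs! (vectors-unique xs! k)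

𝓘ᴮ-unique : ∀ n → Unique (𝓘ᴮ n)
𝓘ᴮ-unique n = Unique.filter⁺ isInvolution? (Unique.filter⁺ isSignedPermutation? (vectors-unique
  (Unique.cartesianProduct⁺ (((λ ()) ∷ []) ∷ [] ∷ []) (Unique.allFin⁺ n)) n))

∈-𝓘ᴮ⁺ : ∀ {n} (π : Word n) → IsSignedPermutation π → IsInvolution π → π ∈ 𝓘ᴮ n
∈-𝓘ᴮ⁺ π bij inv = ∈-filter⁺ isInvolution? (∈-filter⁺ isSignedPermutation?
  (∈-vectors (λ (s , k) → ∈-cartesianProduct⁺ (sign∈ s) (∈-allFin k)) π) bij) inv
  where
  sign∈ : ∀ s → s ∈ Sign.+ ∷ Sign.- ∷ []
  sign∈ Sign.+ = here refl
  sign∈ Sign.- = there (here refl)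

∈-𝓘ᴮ⁻ : ∀ {n} {π : Word n} → π ∈ 𝓘ᴮ n → IsInvolution π
∈-𝓘ᴮ⁻ {n} π∈ = proj₂ (∈-filter⁻ isInvolution? {xs = 𝔅 n} π∈)

lookup-injective : ∀ {n} {u v : Vec A n} → (∀ i → lookup u i ≡ lookup v i) → u ≡ v
lookup-injective {u = u} {v} eq =
  ≡.trans (≡.sym (Vec.tabulate∘lookup u)) (≡.trans (Vec.tabulate-cong eq) (Vec.tabulate∘lookup v))

module Bijection (n m : ℕ) where
  open Labels (suc m)
  open ChainLabels m
  open LabelOrbits m
  open Orbits τ ττ sgn sgn-τ

  Marked : Set
  Marked = Word n × Vec (Fin (suc m)) n

  markings : Word n → List Marked
  markings π = map (π ,_) (chains 0ℤ (Vec.map toℤ π) m)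

  marked : List Marked
  marked = concatMap markings (𝓘ᴮ n)

  marked-unique : Unique marked
  marked-unique = concatMap-unique markings (𝓘ᴮ-unique n)
    (λ π → Unique.map⁺ ,-injectiveʳ (chains-unique 0ℤ (Vec.map toℤ π) m))
    (λ v∈ v∈′ → let _ , _ , eq = ∈-map⁻ _ v∈ ; _ , _ , eq′ = ∈-map⁻ _ v∈′
                in ,-injectiveˡ (≡.trans (≡.sym eq) eq′))

  ∈-marked⁺ : ∀ {π f} → π ∈ 𝓘ᴮ n → Chain zero 0ℤ (Vec.map toℤ π) f → (π , f) ∈ marked
  ∈-marked⁺ {π} π∈ ch =
    ∈-concatMap⁺′ markings π∈ (∈-map⁺ (π ,_) (∈-chains⁺ 0ℤ (Vec.map toℤ π) ch))

  ∈-marked⁻ : ∀ {π f} → (π , f) ∈ marked → IsInvolution π × Chain zero 0ℤ (Vec.map toℤ π) f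
  ∈-marked⁻ πf∈ with ∈-concatMap⁻′ markings (𝓘ᴮ n) πf∈
  ... | π , π∈ , f∈ with ∈-map⁻ (π ,_) f∈
  ...   | f , f∈′ , refl = ∈-𝓘ᴮ⁻ π∈ , ∈-chains⁻ 0ℤ (Vec.map toℤ π) f∈′

  encode : Marked → Vec ℕ (List.length orbits)
  encode (π , f) = restrict (multiplicity (labels π f)) orbits

  module Element {π f} (πf∈ : (π , f) ∈ marked) where
    inv : IsInvolution π
    inv = proj₁ (∈-marked⁻ πf∈)

    C : Compatible τ sgn (labels π f) ∣ π ∣ʷ
    C = compatible π inv f (proj₂ (∈-marked⁻ πf∈))

    covered : ∀ i → ∃ λ r → r ∈ orbits × r ∋ labels π f i
    covered i = cover (labels π f i) (valid π inv f (proj₂ (∈-marked⁻ πf∈)) i)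

    expand-encode : ∀ μ → expand orbits (encode (π , f)) μ ≡ multiplicity (labels π f) μ
    expand-encode = expand-restrict orbits orbits-haveKind orbits-separated
      (multiplicity-τ τ ττ sgn sgn-τ C)
      (multiplicity-support C orbits orbits-haveKind orbits-separated covered)

    encode-∈ : encode (π , f) ∈ multiplicities orbits n
    encode-∈ = subst (λ k → encode (π , f) ∈ multiplicities orbits k)
      (size≡n C orbits orbits-haveKind orbits-separated covered)
      (∈-multiplicities⁺ orbits (encode (π , f)))

    fixᴮ≡fixes : fixᴮ π ≡ fixes orbits (encode (π , f))
    fixᴮ≡fixes = ≡.trans (count-tabulate (λ i → ∣ π ∣ʷ i Fin.≟ i) id)
      (≡.sym (fixes≡∑ C orbits orbits-haveKind orbits-separated covered))

  -- The code gives the multiplicities of all labels, hence the sorted labels. These contain signs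
  -- and blocks, and `compatible-unique` supplies |π|.
  encode-injective : ∀ {x y} → x ∈ marked → y ∈ marked → encode x ≡ encode y → x ≡ y
  encode-injective {π , f} {π′ , f′} x∈ y∈ eq = cong₂ _,_
    (lookup-injective λ i → cong₂ _,_ (signs≡ i) (∣∣≡ i))
    (lookup-injective blocks≡)
    where
    module x = Element x∈
    module y = Element y∈
    L L′ : Fin n → Label
    L  = labels π f
    L′ = labels π′ f′
    L≡L′ : ∀ i → L i ≡ L′ i
    L≡L′ = sorted-unique L L′ (Compatible.monotone x.C) (Compatible.monotone y.C)
      λ κ → ≡.trans (≡.sym (x.expand-encode κ))
        (≡.trans (cong (λ ks → expand orbits ks κ) eq) (y.expand-encode κ))
    ∣∣≡ : ∀ i → ∣ π ∣ʷ i ≡ ∣ π′ ∣ʷ i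
    ∣∣≡ = compatible-unique τ ττ sgn sgn-τ x.C (compatible-cong (≡.sym ∘ L≡L′) y.C)
    unlabel≡ : ∀ i → (lookup f i , proj₁ (lookup π i) , lookup f (∣ π ∣ʷ i)) ≡
                     (lookup f′ i , proj₁ (lookup π′ i) , lookup f′ (∣ π′ ∣ʷ i))
    unlabel≡ i = label-injective {lookup f i} {proj₁ (lookup π i)} {lookup f (∣ π ∣ʷ i)} (L≡L′ i)
    blocks≡ : ∀ i → lookup f i ≡ lookup f′ i
    blocks≡ i = cong proj₁ (unlabel≡ i)
    signs≡ : ∀ i → proj₁ (lookup π i) ≡ proj₁ (lookup π′ i)
    signs≡ i = cong (proj₁ ∘ proj₂) (unlabel≡ i)

  encode-surjective : ∀ {ks} → ks ∈ multiplicities orbits n → ∃ λ x → x ∈ marked × encode x ≡ ks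
  encode-surjective {ks} ks∈ =
    decode (≡.trans (∑-expand orbits ks) (∈-multiplicities⁻ orbits ks∈)) (sorted-exists N)
    where
    N : Label → ℕ
    N = expand orbits ks
    decode : ∑ N ≡ n → (∃ λ (L : Fin (∑ N) → Label) → Monotone L × (∀ κ → multiplicity L κ ≡ N κ)) →
      ∃ λ x → x ∈ marked × encode x ≡ ks
    -- The sorted labelling has length `∑ N`, equal to n only by a proof; abstracting the length
    -- lets `refl` identify the two.
    decode eq sorted with ∑ N
    decode refl (L , L-mono , L-mult) | _ = (w , bs) ,
      ∈-marked⁺ (∈-𝓘ᴮ⁺ w (word-signedPermutation C L-valid) (word-involution C L-valid)) (word-chain C L-valid) ,
      ≡.trans
        (restrict-cong orbits λ {r} _ → ≡.trans
          (sum-cong-≗ λ i → cong (λ κ → ι (κ Fin.≟ proj₂ r)) (labels-word C L-valid i))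
          (L-mult (proj₂ r)))
        (restrict-expand orbits ks orbits-haveKind orbits-separated)
      where
      σC = compatible-exists τ ττ sgn sgn-τ L-mono λ κ → ≡.trans (L-mult (τ κ))
        (≡.trans (expand-symmetric orbits ks orbits-haveKind κ) (≡.sym (L-mult κ)))
      C = proj₂ σC
      L-valid : ∀ i → Valid (L i)
      L-valid i = let _ , r∈ , r∋ = expand-support orbits ks (L i)
                        (∃⇒multiplicity≢0 L i ∘ ≡.trans (L-mult (L i)))
                  in covered⇒valid r∈ r∋
      w = word C L-valid
      bs = blocks C L-valid

module Coefficients (R : CommutativeRing c ℓ) (x : CommutativeRing.Carrier R) where
  private
    module R = CommutativeRing R
  open RawSemiring (RawRing.rawSemiring R.rawRing) using (_^_)
  open ListSum R.+-commutativeMonoid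
  open SetoidReasoning R.setoid

  -- The common value of both sides at t^m z^n.
  coefficient : ℕ → ℕ → R.Carrier
  coefficient m n = ∑ˡ (multiplicities (LabelOrbits.orbits m) n) (λ ks → x ^ fixes (LabelOrbits.orbits m) ks)

  ∑-markings : ∀ m n →
    ∑ˡ (𝓘ᴮ n) (λ π → ∑ˡ (chains 0ℤ (Vec.map toℤ π) m) (λ _ → x ^ fixᴮ π)) R.≈ coefficient m n
  ∑-markings m n = begin
    ∑ˡ (𝓘ᴮ n) (λ π → ∑ˡ (chains 0ℤ (Vec.map toℤ π) m) (λ _ → x ^ fixᴮ π))
      ≈⟨ ∑ˡ-cong (𝓘ᴮ n) (λ {π} _ → R.reflexive (∑ˡ-map weight (π ,_) (chains 0ℤ (Vec.map toℤ π) m))) ⟨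
    ∑ˡ (𝓘ᴮ n) (λ π → ∑ˡ (markings π) weight)
      ≈⟨ ∑ˡ-concatMap weight markings (𝓘ᴮ n) ⟨
    ∑ˡ marked weight
      ≈⟨ ∑ˡ-bijection encode weight (λ ks → x ^ fixes (LabelOrbits.orbits m) ks)
           marked-unique (multiplicities-unique (LabelOrbits.orbits m) n)
           encode-injective Element.encode-∈ encode-surjective
           (λ xy∈ → R.reflexive (cong (x ^_) (Element.fixᴮ≡fixes xy∈))) ⟩
    coefficient m n ∎
    where
    open Bijection n m
    weight : Marked → R.Carrier
    weight (π , _) = x ^ fixᴮ π

-- Coefficient extraction and the two limits

module Extraction (R : CommutativeRing c ℓ) where
  private
    module R = CommutativeRing R
  open SeriesRing R using (commutativeRing; const-*≈; X*-zero; X*-suc; const-homo-*)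
  open CommutativeRing commutativeRing hiding (zero; _-_) renaming (refl to ≈-refl)
  open PowerSeries R.rawRing using (X; const; _^_; sum)
  open RawSemiring (RawRing.rawSemiring R.rawRing) using () renaming (_^_ to _^ᴿ_; sum to sumᴿ)
  open ListSum +-commutativeMonoid
  open ListSum R.+-commutativeMonoid using () renaming (∑ˡ to ∑ᴿ)

  δ : ℕ → ℕ → R.Carrier
  δ zero    zero    = R.1#
  δ zero    (suc k) = R.0#
  δ (suc m) zero    = R.0#
  δ (suc m) (suc k) = δ m k

  X^≈δ : ∀ m → X ^ m ≈ δ m
  X^≈δ zero    zero    = R.refl
  X^≈δ zero    (suc k) = R.refl
  X^≈δ (suc m) zero    = X*-zero (X ^ m)
  X^≈δ (suc m) (suc k) = R.trans (X*-suc (X ^ m) k) (X^≈δ m k)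

  const*X^ : ∀ a m k → (const a * X ^ m) k R.≈ a R.* δ m k
  const*X^ a m k = R.trans (const-*≈ a (X ^ m) k) (R.*-congˡ (X^≈δ m k))

  -- Only one term reaches a given coefficient, so the partial sums are stationary once n exceeds k.
  sum-δ : ∀ (a : ℕ → R.Carrier) {n} k → k ℕ.< n →
    sumᴿ {n} (λ i → a (toℕ i) R.* δ (toℕ i) k) R.≈ a k
  sum-δ a {suc n} zero    k<n = R.trans
    (R.+-cong (R.*-identityʳ (a 0)) (zeros (a ∘ suc) n)) (R.+-identityʳ (a 0))
    where
    zeros : ∀ (b : ℕ → R.Carrier) n → sumᴿ {n} (λ i → b (toℕ i) R.* R.0#) R.≈ R.0#
    zeros b zero    = R.refl
    zeros b (suc n) = R.trans (R.+-cong (R.zeroʳ (b 0)) (zeros (b ∘ suc) n)) (R.+-identityʳ R.0#)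
  sum-δ a {suc n} (suc k) k<n = R.trans
    (R.+-cong (R.zeroʳ (a 0)) (sum-δ (a ∘ suc) k (s≤s⁻¹ k<n))) (R.+-identityˡ _)

  sum-coeff : ∀ {n} (g : Fin n → Carrier) k → sum g k ≡ sumᴿ (λ i → g i k)
  sum-coeff {zero}  g k = refl
  sum-coeff {suc n} g k = cong (g zero k R.+_) (sum-coeff (g ∘ suc) k)

  const-^ : ∀ a m → const a ^ m ≈ const (a ^ᴿ m)
  const-^ a zero    = ≈-refl
  const-^ a (suc m) = trans (*-congˡ {const a} (const-^ a m)) (sym (const-homo-* a (a ^ᴿ m)))

  const-∑ˡ : ∀ (xs : List A) (w : A → R.Carrier) → ∑ˡ xs (const ∘ w) ≈ const (∑ᴿ xs w)
  const-∑ˡ []       w zero    = R.refl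
  const-∑ˡ []       w (suc k) = R.refl
  const-∑ˡ (x ∷ xs) w zero    = R.+-congˡ (const-∑ˡ xs w zero)
  const-∑ˡ (x ∷ xs) w (suc k) = R.trans (R.+-identityˡ _) (const-∑ˡ xs w (suc k))

module Terms {c ℓ : Level} (S : RawRing c ℓ) (x : RawRing.Carrier S) where
  private
    module T = PowerSeries S
  open PowerSeries T.rawRing hiding (_≈_)
  open RawSemiring (RawRing.rawSemiring S) using () renaming (_^_ to _^ˢ_)
  open Quotient T.rawRing (T.const x)

  leftCoefficient : ℕ → T.Carrier
  leftCoefficient n =
    T.sumList (map (λ π → T.const (x ^ˢ fixᴮ π) T.* T.X T.^ desᴮ π) (𝓘ᴮ n)) T./
    (T.1# T.- T.X) T.^ suc n

  leftTerm rightTerm : ℕ → Carrier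
  leftTerm n = const (leftCoefficient n) * X ^ n
  rightTerm m = const T.X ^ m * quotient m

  -- A record, so that instances at definitionally equal rings are compared by
  -- their parameters instead of by unfolding the two series.
  record Identity : Set (c ⊔ ℓ) where
    open RawRing S using (_≈_)
    field
      limit : Carrier
      left  : ∀ i j n → j ℕ.< n → sum {n} (leftTerm ∘ toℕ) j i ≈ limit j i
      right : ∀ i j n → i ℕ.< n → sum {n} (rightTerm ∘ toℕ) j i ≈ limit j i

module DoubleSeries (R : CommutativeRing c ℓ) (x : CommutativeRing.Carrier R) where
  private
    module R = CommutativeRing R
    T = SeriesRing.commutativeRing R
    module T = CommutativeRing T
    module Z = CommutativeRing (SeriesRing.commutativeRing T)
    module PT = PowerSeries R.rawRing
    module PZ = PowerSeries PT.rawRing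
    module ER = Extraction R
    module ET = Extraction T
    module MR = MonoidSum R.+-monoid
    module MT = MonoidSum T.+-monoid
  open RawSemiring (RawRing.rawSemiring R.rawRing) using () renaming (_^_ to _^ᴿ_)
  open Coefficients R x
  open Terms R.rawRing x
  open ListSum T.+-commutativeMonoid using (∑ˡ; ∑ˡ-cong)

  limit : PZ.Carrier
  limit n m = coefficient m n

  left-sum : ∀ i j n → j ℕ.< n → PZ.sum {n} (leftTerm ∘ toℕ) j i R.≈ limit j i
  left-sum i j n j<n = R.trans
    (R.reflexive (cong (λ f → f i) (ET.sum-coeff {n} (leftTerm ∘ toℕ) j)))
    (R.trans (MT.sum-cong-≋ {n} (λ k → ET.const*X^ (leftCoefficient (toℕ k)) (toℕ k) j) i)
      (R.trans (ET.sum-δ leftCoefficient {n} j j<n i)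
        (R.trans (DescentSeries.descentSeries R (𝓘ᴮ j) (λ π → x ^ᴿ fixᴮ π) i)
          (∑-markings i j))))

  -- The quotient lives over series in t but does not involve t, so its product with t^m reaches the
  -- single power t^m.
  orbitSeries-const : ∀ m j →
    MultiplicitySeries.series T (PT.const x) (LabelOrbits.orbits m) j T.≈ PT.const (coefficient m j)
  orbitSeries-const m j = T.trans
    (∑ˡ-cong (multiplicities (LabelOrbits.orbits m) j) (λ {ks} _ → ER.const-^ x (fixes (LabelOrbits.orbits m) ks)))
    (ER.const-∑ˡ (multiplicities (LabelOrbits.orbits m) j) (λ ks → x ^ᴿ fixes (LabelOrbits.orbits m) ks))

  rightTerm-coeff : ∀ m j i → rightTerm m j i R.≈ coefficient m j R.* ER.δ m i
  rightTerm-coeff m j i = R.trans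
    (Z.*-cong (ET.const-^ PT.X m) (OrbitSeries.orbitSeries T (PT.const x) m) j i)
    (R.trans (SeriesRing.const-*≈ T (PT.X PT.^ m) series j i)
      (R.trans (T.*-congˡ {PT.X PT.^ m} (orbitSeries-const m j) i)
        (R.trans (T.*-comm (PT.X PT.^ m) (PT.const (coefficient m j)) i)
          (ER.const*X^ (coefficient m j) m i))))
    where series = MultiplicitySeries.series T (PT.const x) (LabelOrbits.orbits m)

  right-sum : ∀ i j n → i ℕ.< n → PZ.sum {n} (rightTerm ∘ toℕ) j i R.≈ limit j i
  right-sum i j n i<n = R.trans
    (R.reflexive (≡.trans (cong (λ f → f i) (ET.sum-coeff {n} (rightTerm ∘ toℕ) j))
      (ER.sum-coeff {n} (λ k → rightTerm (toℕ k) j) i)))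
    (R.trans (MR.sum-cong-≋ {n} (λ k → rightTerm-coeff (toℕ k) j i))
      (ER.sum-δ (λ m → coefficient m j) {n} i i<n))

  identity : Identity
  identity = record { limit = limit ; left = left-sum ; right = right-sum }

theorem1p1 : let open ℤ[p]⟦t⟧⟦z⟧
                 module T = ℤ[p]⟦t⟧
    in
    ∃ λ (S : Carrier) →
    HasSum (λ n → const (𝓕 n T./ ((T.1# T.- T.X) T.^ suc n)) * z ^ n) S
    ×
    HasSum (λ m → t ^ m *
    ((1# + p * z) ^ m
    / ((1# - p * z) ^ suc m * (1# - z ^ 2) ^ (m ℕ.* suc m)))) S
-- On the left only the term n = j meets z^j, and on the right only m = i meets t^i; each partial
-- sum must include that index.
theorem1p1 = limit , (λ i j → suc j , left i j) , (λ i j → suc i , right i j)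
  where
  identity : Terms.Identity ℤ[p].rawRing ℤ[p].X
  identity = DoubleSeries.identity ℤ[p]-commutativeRing ℤ[p].X
  open Terms.Identity identity
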